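{- Let $P_2(n)$ be the number of payphone permutations of type (P2) and size $n$. Then for any integer $n\geq 1$, $$P_2(n) = \sum_{i=1}^n F\big(S'(i-1)\cup S'(n-i)\big),$$ where $$S'(\ell) := \begin{cases} \emptyset, & \text{if } \ell=0; \\ S(\ell-1) \cup \{2\ell-1\}, & \text{if } \ell\geq 1. \end{cases}$$
   Context: Multisets: $\#_k M$ denotes the multiplicity of $k$ in the multiset $M$, and $\cup$ denotes union of multisets with multiplicities added. For $n\ge 0$, the finite multiset $S(n)$ of positive integers is defined recursively by $S(0)=\emptyset$ and $$S(n)=\{n\}\cup S\left(\left\lfloor\tfrac{n-1}{2}\right\rfloor\right)\cup S\left(\left\lceil\tfrac{n-1}{2}\right\rceil\right)\quad (n\ge 1).$$ The function $F$ is defined on the finite multisets $M$ of positive integers by $$F(M) := \bigg(\prod_{k\geq 1} (\#_k M)!\bigg)\cdot 2^{\sum_{k\geq 1} \#_{2k} M}.$$ Type (P2) payphone permutations: $n$ payphones, labeled $1,\dots,n$, are arranged in a row; the distance between payphones $i$ and $j$ is $|i-j|$. Persons $1,2,\dots,n$ come one after another and each occupies an available payphone. The first person takes any payphone. Each subsequent person obeys the following rule (P2). An interval is a maximal sequence of available consecutive payphones; its length is the number of payphones in it. An interval is semi-closed or closed if it is flanked by $1$ or $2$ occupied payphones, respectively. The full length of a closed interval is its length; the full length of a semi-closed interval of length $\ell$ is $2\ell-1$. The person first selects any interval of greatest full length and then takes, within it, any payphone whose distance to its closest occupied payphone is as large as possible. The resulting assignment of people to payphones, $(p_1,\dots,p_n)$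 with $p_j$ the person occupying payphone $j$, is a payphone permutation of type (P2) and size $n$; $P_2(n)$ counts the distinct permutations of $\{1,\dots,n\}$ that can arise this way. -}

module Defs where

open import Data.Fin as Fin using (Fin; toℕ)
open import Data.List using (List; []; _∷_; _++_; length; filter; foldr; map; applyUpTo)
open import Data.List.Membership.Propositional using (_∈_)
open import Data.List.Relation.Unary.Unique.Propositional using (Unique)
open import Data.Maybe using (Maybe; just; nothing)
open import Data.Nat
open import Data.Nat.ListAction using (sum; product)
open import Data.Nat.Induction using (<-wellFounded; <-rec)
open import Data.Nat.Properties using (_≟_; ⌊n/2⌋≤n; ⌈n/2⌉≤n)
open import Data.Product using (Σ; ∃; _×_; _,_)
open import Data.Vec as Vec using (Vec; lookup; replicate; _[_]≔_)
open import Function.Bundles using (_⇔_)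
open import Induction.WellFounded using (module FixPoint)
open import Relation.Binary.PropositionalEquality using (_≡_; refl; cong₂; cong)
open import Relation.Nullary using (¬_)

-- "Exactly N objects x satisfy P x."
HasCardinality : {A : Set} → (A → Set) → ℕ → Set
HasCardinality {A} P N =
  Σ (List A) λ xs → Unique xs × (∀ x → x ∈ xs ⇔ P x) × length xs ≡ N

[1⋯_] : ℕ → List ℕ
[1⋯ n ] = applyUpTo suc n

------------------------------------------------------------------------
-- Multisets

-- A finite multiset of positive integers is given by any listing of its
-- elements with repetition; F sees a list only through its multiplicities #.
Multiset : Set
Multiset = List ℕ

∅ : Multiset
∅ = []

infixr 5 _∪_

_∪_ : Multiset → Multiset → Multiset
_∪_ = _++_

# : ℕ → Multiset → ℕ
# k M = length (filter (k ≟_) M)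

maximum : Multiset → ℕ
maximum = foldr _⊔_ 0

-- The product and the sum over all k ≥ 1 are cut off at the largest element
-- of M: beyond it # k M = # (2 * k) M = 0.
F : Multiset → ℕ
F M = product (map (λ k → (# k M) !) [1⋯ maximum M ])
    * 2 ^ sum (map (λ k → # (2 * k) M) [1⋯ maximum M ])

-- The argument suc m is the n of the recursion, so that n - 1 is m.
S-step : ∀ n → (∀ {m} → m < n → Multiset) → Multiset
S-step zero    rec = ∅
S-step (suc m) rec =
  (suc m ∷ []) ∪ rec {⌊ m /2⌋} (s≤s (⌊n/2⌋≤n m)) ∪ rec {⌈ m /2⌉} (s≤s (⌈n/2⌉≤n m))

S : ℕ → Multiset
S = <-rec (λ _ → Multiset) S-step

S-zero : S 0 ≡ ∅
S-zero = refl

S-suc : ∀ m → S (suc m) ≡ (suc m ∷ []) ∪ S ⌊ m /2⌋ ∪ S ⌈ m /2⌉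
S-suc m = FixPoint.unfold-wfRec <-wellFounded (λ _ → Multiset) S-step ext {suc m}
  where
  ext : ∀ n {f g : ∀ {m} → m < n → Multiset} →
        (∀ {m} (m<n : m < n) → f m<n ≡ g m<n) → S-step n f ≡ S-step n g
  ext zero    f≗g = refl
  ext (suc m) f≗g = cong (suc m ∷_) (cong₂ _++_ (f≗g _) (f≗g _))

S' : ℕ → Multiset
S' zero      = ∅
S' ℓ@(suc m) = S m ∪ (2 * ℓ ∸ 1 ∷ [])

------------------------------------------------------------------------
-- Payphones

-- The entry of a payphone is the person occupying it, if any.  Persons are
-- numbered from 1; the payphone at index j : Fin n is the one labelled suc (toℕ j).
State : ℕ → Set
State n = Vec (Maybe ℕ) n

module _ {n : ℕ} (s : State n) where

  Available : Fin n → Set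
  Available i = lookup s i ≡ nothing

  Occupied : Fin n → Set
  Occupied i = ∃ λ person → lookup s i ≡ just person

  AvailableRun : (a b : Fin n) → Set
  AvailableRun a b = a Fin.≤ b × (∀ i → a Fin.≤ i → i Fin.≤ b → Available i)

  Interval : (a b : Fin n) → Set
  Interval a b = AvailableRun a b ×
    (∀ a' b' → a' Fin.≤ a → b Fin.≤ b' → AvailableRun a' b' → a' ≡ a × b' ≡ b)

  FlankedLeft : Fin n → Set
  FlankedLeft a = ∃ λ i → suc (toℕ i) ≡ toℕ a × Occupied i

  FlankedRight : Fin n → Set
  FlankedRight b = ∃ λ i → toℕ i ≡ suc (toℕ b) × Occupied i

  size : (a b : Fin n) → ℕ
  size a b = suc (toℕ b ∸ toℕ a)

  data FullLength (a b : Fin n) : ℕ → Set where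
    closed      : FlankedLeft a → FlankedRight b → FullLength a b (size a b)
    semiClosedˡ : FlankedLeft a → ¬ FlankedRight b → FullLength a b (2 * size a b ∸ 1)
    semiClosedʳ : ¬ FlankedLeft a → FlankedRight b → FullLength a b (2 * size a b ∸ 1)

  -- d is the distance from j to its closest occupied payphone.
  ClosestOccupied : Fin n → ℕ → Set
  ClosestOccupied j d =
    (∃ λ i → Occupied i × ∣ toℕ j - toℕ i ∣ ≡ d) ×
    (∀ i → Occupied i → d ≤ ∣ toℕ j - toℕ i ∣)

  GreatestInterval : (a b : Fin n) → Set
  GreatestInterval a b = Interval a b × ∃ λ L → FullLength a b L ×
    (∀ a' b' L' → Interval a' b' → FullLength a' b' L' → L' ≤ L)

  FarthestIn : (a b j : Fin n) → Set
  FarthestIn a b j = a Fin.≤ j × j Fin.≤ b × ∃ λ d → ClosestOccupied j d ×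
    (∀ j' d' → a Fin.≤ j' → j' Fin.≤ b → ClosestOccupied j' d' → d' ≤ d)

  P2-Choice : Fin n → Set
  P2-Choice j = ∃ λ a → ∃ λ b → GreatestInterval a b × FarthestIn a b j

-- Reachable t s: s can arise once persons 1, …, t have each taken a payphone.
data Reachable {n : ℕ} : ℕ → State n → Set where
  first : ∀ j → Reachable 1 (replicate n nothing [ j ]≔ just 1)
  next  : ∀ {t s} j → Reachable t s → P2-Choice s j →
          Reachable (suc t) (s [ j ]≔ just (suc t))

P2-Permutation : (n : ℕ) → Vec ℕ n → Set
P2-Permutation n p = Reachable n (Vec.map just p)

{-# OPTIONS --safe #-}

-- Let T(s) be the multiset of the full lengths of all intervals, present or
-- future, from which a payphone is still to be taken in state s.  Whichever
-- payphone is chosen next, T(s) loses exactly one copy of its maximum L.  The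
-- number of choices is #_L T(s), doubled if L is even (only then does an interval
-- have two middle payphones), which is F(T(s)) / F(T(s) minus one L).  Hence
-- summing F(T(s)) over the states reachable after t persons gives a value that does
-- not depend on t: it is the right-hand side for t = 1, and the number of
-- permutations for t = n, where T(s) is empty and F(∅) = 1.

module Submission where

open import Algebra.Bundles using (CommutativeMonoid)
open import Data.Fin as Fin using (Fin; zero; suc; toℕ; fromℕ<)
import Data.Fin.Properties as Fin
open import Data.List using (List; []; _∷_; _++_; allFin; applyUpTo; cartesianProduct; concatMap; filter; foldr;
  length; map; tabulate; upTo)
open import Data.List.Properties using (++-identityʳ; concatMap-++; filter-++; filter-accept; filter-none; filter-reject;
  length-++; length-map; map-++; map-applyUpTo; map-cong; map-id-local; map-tabulate; map-∘)
open import Data.List.Membership.Propositional using (_∈_; find; lose)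
open import Data.List.Membership.Propositional.Properties
open import Data.List.Membership.Propositional.Properties.WithK using (unique∧set⇒bag)
open import Data.List.Relation.Binary.BagAndSetEquality using (∼bag⇒↭)
open import Data.List.Relation.Binary.Permutation.Propositional as Perm using (_↭_; ↭-prep; ↭-refl; ↭-reflexive; ↭-sym; ↭-trans)
open import Data.List.Relation.Binary.Permutation.Propositional.Properties
  using (++-comm; ++⁺ʳ; ++⁺ˡ; filter-↭; shifts; ↭-length; ∷↭∷ʳ)
open import Data.List.Relation.Unary.All as All using (All; []; _∷_)
open import Data.List.Relation.Unary.AllPairs using ([]; _∷_)
open import Data.List.Relation.Unary.Any using (here; there)
open import Data.List.Relation.Unary.Unique.Propositional using (Unique)
import Data.List.Relation.Unary.Unique.Propositional.Properties as Unique
open import Data.Maybe using (just; nothing; fromMaybe)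
import Data.Maybe.Properties as Maybe
open import Data.Nat
open import Data.Nat.Induction using (<-rec)
open import Data.Nat.ListAction using (sum; product)
open import Data.Nat.ListAction.Properties using (sum-++)
open import Data.Nat.Properties
open import Data.Nat.Tactic.RingSolver using (solve-∀)
open import Data.List.Membership.DecPropositional _≟_ using (_∈?_)
open import Data.Product using (∃; _×_; _,_; proj₁; proj₂)
open import Data.Product.Properties using (≡-dec)
open import Data.Sum using (_⊎_; inj₁; inj₂)
open import Data.Vec as Vec using (Vec; []; _∷_; lookup; replicate; _[_]≔_)
import Data.Vec.Properties as Vec
open import Function using (_∘_; id; mk⇔)
open import Level using (0ℓ)
open import Relation.Binary.PropositionalEquality using (_≡_; _≢_; refl; sym; trans; cong; cong₂; subst; subst₂; module ≡-Reasoning)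
open import Relation.Nullary using (¬_; Dec; yes; no; ¬?; contradiction)
open import Relation.Nullary.Decidable using (_×-dec_; map′)
open import Relation.Unary using (Decidable)
open import Defs

-- Multiplicities and F

-- Full lengths put both types of interval on one scale: the best payphone of a semi-closed interval
-- of length ℓ is its end payphone, at distance ℓ, just as the middle of a closed interval of length
-- 2ℓ - 1. Taking it leaves one closed interval of length ℓ - 1, whence `S' ℓ`; and 2ℓ - 1 is odd,
-- in accordance with the single choice. A closed interval leaves its two rounded halves, which is
-- the recursion of `S`; choosing the other middle only interchanges them. Whatever arises inside an
-- interval is strictly shorter than its full length, so the maximum of T(s) comes from present
-- intervals only, once from each, and its multiplicity counts them. The number of choices can
-- differ between states with equally many persons (for n = 3 the second person has one or two).
-- Hence no product of such numbers is formed; a weighted sum over the states is carried along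
-- instead. The empty row stands apart: its interval is flanked on neither side and has no full
-- length. So the invariant starts at t = 1, and the lemmas on the rule assume
-- `¬ Gap (Vacant s) 0 n`.

module _ (M : CommutativeMonoid 0ℓ 0ℓ) where
  open CommutativeMonoid M renaming (Carrier to C; refl to ≈-refl; trans to ≈-trans; sym to ≈-sym)
  open import Relation.Binary.Reasoning.Setoid setoid

  private
    -- An arbitrary commutative monoid lets each lemma serve both the product of factorials in `F`
    -- and the sum in its exponent of 2.
    fold : (ℕ → C) → ℕ → C
    fold f n = foldr _∙_ ε (applyUpTo f n)

  fold-ε : ∀ {f} n → (∀ k → f k ≈ ε) → fold f n ≈ ε
  fold-ε zero    f≈ε = ≈-refl
  fold-ε (suc n) f≈ε = ≈-trans (∙-cong (f≈ε 0) (fold-ε n (f≈ε ∘ suc))) (identityˡ ε)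

  fold-cutoff : ∀ {f m n} → m ≤ n → (∀ k → m ≤ k → f k ≈ ε) → fold f n ≈ fold f m
  fold-cutoff {n = n} z≤n f≈ε = fold-ε n (λ k → f≈ε k z≤n)
  fold-cutoff (s≤s m≤n)   f≈ε = ∙-congˡ (fold-cutoff m≤n (λ k m≤k → f≈ε (suc k) (s≤s m≤k)))

  fold-cong : ∀ {f g} n → (∀ k → f k ≈ g k) → fold f n ≈ fold g n
  fold-cong zero    f≈g = ≈-refl
  fold-cong (suc n) f≈g = ∙-cong (f≈g 0) (fold-cong n (f≈g ∘ suc))

  -- Adjoining one element to a multiset changes the multiplicity at a single index; this extracts
  -- the effect `c` of that change.
  fold-adjust : ∀ {f g c i n} → i < n → f i ≈ c ∙ g i → (∀ k → k ≢ i → f k ≈ g k) →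
                fold f n ≈ c ∙ fold g n
  fold-adjust {f} {g} {c} {zero} {suc n} _ fi fk = begin
    f 0 ∙ fold (f ∘ suc) n         ≈⟨ ∙-cong fi (fold-cong n (λ k → fk (suc k) λ ())) ⟩
    (c ∙ g 0) ∙ fold (g ∘ suc) n   ≈⟨ assoc _ _ _ ⟩
    c ∙ (g 0 ∙ fold (g ∘ suc) n)   ∎
  fold-adjust {f} {g} {c} {suc i} {suc n} (s≤s i<n) fi fk = begin
    f 0 ∙ fold (f ∘ suc) n         ≈⟨ ∙-cong (fk 0 λ ())
                                        (fold-adjust i<n fi (λ k k≢i → fk (suc k) (k≢i ∘ suc-injective))) ⟩
    g 0 ∙ (c ∙ fold (g ∘ suc) n)   ≈⟨ assoc _ _ _ ⟨
    (g 0 ∙ c) ∙ fold (g ∘ suc) n   ≈⟨ ∙-congʳ (comm _ _) ⟩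
    (c ∙ g 0) ∙ fold (g ∘ suc) n   ≈⟨ assoc _ _ _ ⟩
    c ∙ (g 0 ∙ fold (g ∘ suc) n)   ∎

#-∷-≡ : ∀ k M → # k (k ∷ M) ≡ suc (# k M)
#-∷-≡ k M = cong length (filter-accept (k ≟_) refl)

#-∷-≢ : ∀ {k x} M → k ≢ x → # k (x ∷ M) ≡ # k M
#-∷-≢ M k≢x = cong length (filter-reject (_ ≟_) k≢x)

#-> : ∀ {k} M → maximum M < k → # k M ≡ 0
#-> []      _ = refl
#-> (x ∷ M) p = trans (#-∷-≢ M (>⇒≢ (m⊔n<o⇒m<o x _ p))) (#-> M (m⊔n<o⇒n<o x _ p))

#-↭ : ∀ {M N} k → M ↭ N → # k M ≡ # k N
#-↭ k p = ↭-length (filter-↭ (k ≟_) p)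

-- The range in `F` depends on the multiset. A free bound `N` allows two multisets to be compared
-- index by index over a common range.
F-upTo : ℕ → Multiset → ℕ
F-upTo N M = product (applyUpTo (λ k → (# (suc k) M) !) N) * 2 ^ sum (applyUpTo (λ k → # (2 * suc k) M) N)

-- Beyond the maximum all multiplicities are 0, and 0! = 1 and 0 are the neutral elements of the two
-- folds.
F-cutoff : ∀ {N} M → maximum M ≤ N → F M ≡ F-upTo N M
F-cutoff {N} M max≤N = cong₂ (λ p s → p * 2 ^ s)
  (trans (cong product (map-applyUpTo suc (λ k → (# k M) !) (maximum M)))
         (sym (fold-cutoff *-1-commutativeMonoid max≤N λ k le → cong _! (#-> M (s≤s le)))))
  (trans (cong sum (map-applyUpTo suc (λ k → # (2 * k) M) (maximum M)))
         (sym (fold-cutoff +-0-commutativeMonoid max≤N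
           λ k le → #-> M (≤-trans (s≤s le) (m≤m+n (suc k) _)))))

F-↭ : ∀ {M N} → M ↭ N → F M ≡ F N
F-↭ {M} {N} M↭N = begin
  F M         ≡⟨ F-cutoff M (m≤m⊔n _ _) ⟩
  F-upTo k M  ≡⟨ cong₂ (λ p s → p * 2 ^ s)
                   (fold-cong *-1-commutativeMonoid k (λ i → cong _! (#-↭ (suc i) M↭N)))
                   (fold-cong +-0-commutativeMonoid k (λ i → #-↭ (2 * suc i) M↭N)) ⟩
  F-upTo k N  ≡⟨ F-cutoff N (m≤n⊔m (maximum M) _) ⟨
  F N         ∎
  where
  open ≡-Reasoning
  k = maximum M ⊔ maximum N

-- The offsets from the left end of the middle payphones of a closed interval
-- of length suc m.
halves : ℕ → List ℕ
halves 0             = 0 ∷ []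
halves 1             = 0 ∷ 1 ∷ []
halves (suc (suc m)) = map suc (halves m)

middles : ℕ → ℕ
middles m = length (halves m)

-- The even case returns half the length minus one, because that is the index at which the exponent
-- in `F-upTo` counts the element `suc m`.
middles-parity : ∀ m → (∃ λ k → suc m ≡ 2 * suc k × middles m ≡ 2) ⊎
                       ((∀ k → suc m ≢ 2 * k) × middles m ≡ 1)
middles-parity 0 = inj₂ (odd , refl)
  where
  odd : ∀ k → 1 ≢ 2 * k
  odd (suc k) eq with () ← trans (suc-injective eq) (+-suc k _)
middles-parity 1 = inj₁ (0 , refl , refl)
middles-parity (suc (suc m)) with middles-parity m
... | inj₁ (k , eq , two) =
  inj₁ (suc k , trans (cong (2 +_) eq) (sym (*-suc 2 (suc k))) , trans (length-map suc (halves m)) two)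
... | inj₂ (odd , one) = inj₂ (odd′ , trans (length-map suc (halves m)) one)
  where
  odd′ : ∀ k → 3 + m ≢ 2 * k
  odd′ (suc k) eq = odd k (suc-injective (suc-injective (trans eq (*-suc 2 k))))

-- The new element turns one factorial (c - 1)! into c!, and it raises the exponent by one exactly
-- if `suc m` is even. The latter is a factor 2 or 1, which is `middles m`.
F-∷ : ∀ m M → F (suc m ∷ M) ≡ # (suc m) (suc m ∷ M) * middles m * F M
F-∷ m M = begin
  F (suc m ∷ M)         ≡⟨ F-cutoff (suc m ∷ M) ≤-refl ⟩
  F-upTo N (suc m ∷ M)  ≡⟨ cong₂ _*_ prod-eq pow-eq ⟩
  (c * P) * (middles m * Q)  ≡⟨ lem c P (middles m) Q ⟩
  c * middles m * (P * Q)    ≡⟨ cong (c * middles m *_) (sym (F-cutoff M (m≤n⊔m (suc m) _))) ⟩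
  c * middles m * F M   ∎
  where
  open ≡-Reasoning
  N = maximum (suc m ∷ M)
  c = # (suc m) (suc m ∷ M)
  P = product (applyUpTo (λ k → (# (suc k) M) !) N)
  Q = 2 ^ sum (applyUpTo (λ k → # (2 * suc k) M) N)
  lem : ∀ c P s Q → (c * P) * (s * Q) ≡ c * s * (P * Q)
  lem = solve-∀
  prod-eq : product (applyUpTo (λ k → (# (suc k) (suc m ∷ M)) !) N) ≡ c * P
  prod-eq = fold-adjust *-1-commutativeMonoid {c = c} {i = m} (m≤m⊔n (suc m) (maximum M))
    (trans (cong _! (#-∷-≡ (suc m) M)) (cong (_* (# (suc m) M) !) (sym (#-∷-≡ (suc m) M))))
    (λ k k≢m → cong _! (#-∷-≢ M (k≢m ∘ suc-injective)))
  pow-eq : 2 ^ sum (applyUpTo (λ k → # (2 * suc k) (suc m ∷ M)) N) ≡ middles m * Q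
  pow-eq with middles-parity m
  ... | inj₁ (i , eq , two) rewrite two = cong (2 ^_)
    (fold-adjust +-0-commutativeMonoid {i = i}
      (≤-trans (≤-trans (m≤m+n (suc i) _) (≤-reflexive (sym eq))) (m≤m⊔n (suc m) (maximum M)))
      (trans (cong (# (2 * suc i) ∘ (_∷ M)) eq) (#-∷-≡ (2 * suc i) M))
      (λ k k≢i → #-∷-≢ M (k≢i ∘ λ e → suc-injective (*-cancelˡ-≡ (suc k) (suc i) 2 (trans e eq)))))
  ... | inj₂ (odd , one) rewrite one = trans (cong (2 ^_)
    (fold-cong +-0-commutativeMonoid N (λ k → #-∷-≢ M (odd (suc k) ∘ sym)))) (sym (+-identityʳ _))

-- Intervals as maximal runs

-- A maximal run [lo, hi) of a predicate; hi is excluded, so that splitting an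
-- interval at j leaves [lo, j) and [j + 1, hi), either of which may be empty.
record Gap (A : ℕ → Set) (lo hi : ℕ) : Set where
  field
    lo<hi : lo < hi
    run   : ∀ {k} → lo ≤ k → k < hi → A k
    left  : ∀ {k} → suc k ≡ lo → ¬ A k
    right : ¬ A hi

open Gap

module _ {A : ℕ → Set} where

  private
    left-end-≤ : ∀ {a c p} → c ≤ p → (∀ {k} → c ≤ k → suc k ≤ p → A k) →
                 (∀ {k} → suc k ≡ a → ¬ A k) → a ≤ p → a ≤ c
    left-end-≤ {zero}  _   _ _       _   = z≤n
    left-end-≤ {suc a} c≤p Acp blocked a≤p with suc a ≤? _
    ... | yes a≤c = a≤c
    ... | no  a≰c = contradiction (Acp (s≤s⁻¹ (≰⇒> a≰c)) a≤p) (blocked refl)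

    right-end-≤ : ∀ {b d p} → p ≤ b → (∀ {k} → p ≤ k → k < d → A k) → ¬ A b → d ≤ b
    right-end-≤ p≤b Apd ¬Ab = ≮⇒≥ (¬Ab ∘ Apd p≤b)

  -- If the left ends differed, the point just before the larger one would lie in the other run;
  -- similarly on the right. Thus a payphone determines its interval, which later keeps the choices
  -- in different intervals disjoint.
  gap-unique : ∀ {a b c d j} → Gap A a b → Gap A c d →
               a ≤ j → j < b → c ≤ j → j < d → a ≡ c × b ≡ d
  gap-unique g h a≤j j<b c≤j j<d =
    ≤-antisym (left-end-≤ c≤j (λ c≤k k<j → run h c≤k (<-trans k<j j<d)) (left g) a≤j)
              (left-end-≤ a≤j (λ a≤k k<j → run g a≤k (<-trans k<j j<b)) (left h) c≤j) ,
    ≤-antisym (right-end-≤ (<⇒≤ j<d) (run g ∘ ≤-trans a≤j) (right h))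
              (right-end-≤ (<⇒≤ j<b) (run h ∘ ≤-trans c≤j) (right g))

  gap-dec : Decidable A → ∀ a b → Dec (Gap A a b)
  gap-dec A? a b = map′ to from (a <? b ×-dec allUpTo? within? b ×-dec left? a ×-dec ¬? (A? b))
    where
    to : a < b × (∀ {k} → k < b → a ≤ k → A k) × (∀ {k} → suc k ≡ a → ¬ A k) × ¬ A b → Gap A a b
    to (lt , r , l , ¬Ab) = record { lo<hi = lt ; run = λ a≤k k<b → r k<b a≤k ; left = l ; right = ¬Ab }
    from : Gap A a b → a < b × (∀ {k} → k < b → a ≤ k → A k) × (∀ {k} → suc k ≡ a → ¬ A k) × ¬ A b
    from g = lo<hi g , (λ k<b a≤k → run g a≤k k<b) , left g , right g
    within? : ∀ k → Dec (a ≤ k → A k)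
    within? k with a ≤? k | A? k
    ... | yes _   | yes Ak = yes (λ _ → Ak)
    ... | yes a≤k | no ¬Ak = no (λ f → ¬Ak (f a≤k))
    ... | no a≰k  | _      = yes (λ a≤k → contradiction a≤k a≰k)
    left? : ∀ a → Dec (∀ {k} → suc k ≡ a → ¬ A k)
    left? zero    = yes λ ()
    left? (suc k) = map′ (λ { ¬Ak refl → ¬Ak }) (λ f → f refl) (¬? (A? k))

  module _ (A? : Decidable A) where

    private
      extend-left : ∀ k → A k → ∃ λ a → a ≤ k × (∀ {i} → a ≤ i → i ≤ k → A i) × (∀ {i} → suc i ≡ a → ¬ A i)
      extend-left zero    Ak = 0 , z≤n , (λ { z≤n z≤n → Ak }) , λ ()
      extend-left (suc k) Ask with A? k
      ... | no ¬Ak = suc k , ≤-refl , (λ p q → subst A (≤-antisym p q) Ask) , λ { refl → ¬Ak }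
      ... | yes Ak with a , a≤k , r , l ← extend-left k Ak = a , m≤n⇒m≤1+n a≤k , r′ , l
        where
        r′ : ∀ {i} → a ≤ i → i ≤ suc k → A i
        r′ a≤i i≤1+k with m≤n⇒m<n∨m≡n i≤1+k
        ... | inj₁ i≤k  = r a≤i (s≤s⁻¹ i≤k)
        ... | inj₂ refl = Ask

      -- The recursion is on the distance `d` from `k` to the bound `n`, where the run must have
      -- stopped.
      extend-right : ∀ {n} → (∀ {k} → A k → k < n) → ∀ d k → k + d ≡ n →
                     ∃ λ b → k ≤ b × (∀ {i} → k ≤ i → i < b → A i) × ¬ A b
      extend-right A<n zero k eq =
        k , ≤-refl , (λ p q → contradiction q (≤⇒≯ p)) , λ Ak → <⇒≢ (A<n Ak) (trans (sym (+-identityʳ k)) eq)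
      extend-right A<n (suc d) k eq with A? k
      ... | no ¬Ak = k , ≤-refl , (λ p q → contradiction q (≤⇒≯ p)) , ¬Ak
      ... | yes Ak with b , k<b , r , ¬Ab ← extend-right A<n d (suc k) (trans (sym (+-suc k d)) eq) =
        b , <⇒≤ k<b , r′ , ¬Ab
        where
        r′ : ∀ {i} → k ≤ i → i < b → A i
        r′ k≤i i<b with m≤n⇒m<n∨m≡n k≤i
        ... | inj₁ k<i  = r k<i i<b
        ... | inj₂ refl = Ak

    gap-around : ∀ {n} → (∀ {k} → A k → k < n) → ∀ {k} → A k → ∃ λ a → ∃ λ b → Gap A a b × a ≤ k × k < b
    gap-around {n} A<n {k} Ak
      with a , a≤k , r , l ← extend-left k Ak
         | b , k<b , r′ , ¬Ab ← extend-right A<n (n ∸ suc k) (suc k) (m+[n∸m]≡n (A<n Ak)) =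
      a , b , record { lo<hi = ≤-trans (s≤s a≤k) k<b ; run = r″ ; left = l ; right = ¬Ab } , a≤k , k<b
      where
      r″ : ∀ {i} → a ≤ i → i < b → A i
      r″ {i} a≤i i<b with i ≤? k
      ... | yes i≤k = r a≤i i≤k
      ... | no  i≰k = r′ (≰⇒> i≰k) i<b

  module _ {A′ : ℕ → Set} {j : ℕ} (A′⇒A : ∀ {k} → A′ k → A k) (¬A′j : ¬ A′ j)
           (A⇒A′ : ∀ {k} → A k → k ≢ j → A′ k)
           {a b : ℕ} (g : Gap A a b) (a≤j : a ≤ j) (j<b : j < b) where

    -- A new run that ends at `j` keeps the old left end, and one that starts after `j` keeps the
    -- old right end. For any other run the points just outside it differ from `j`, so it was
    -- already maximal before.
    gap-split : ∀ {x y} → Gap A′ x y → (Gap A x y × (x , y) ≢ (a , b)) ⊎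
                (x , y) ≡ (a , j) × x < y ⊎ (x , y) ≡ (suc j , b) × x < y
    gap-split {x} {y} h with y ≟ j | x ≟ suc j
    ... | yes refl | _ = inj₂ (inj₁ (cong (_, y) x≡a , lo<hi h))
      where
      x≡a : x ≡ a
      x≡a = ≤-antisym
        (left-end-≤ a≤j (λ p q → run g p (<-trans q j<b))
          (λ { refl Ak → left h refl (A⇒A′ Ak λ k≡y → <⇒≱ (lo<hi h) (m≤n⇒m≤1+n (≤-reflexive (sym k≡y)))) })
          (<⇒≤ (lo<hi h)))
        (left-end-≤ (<⇒≤ (lo<hi h)) (λ p q → A′⇒A (run h p q)) (left g) a≤j)
    ... | no y≢j | yes refl = inj₂ (inj₂ (cong (x ,_) y≡b , lo<hi h))
      where
      y≡b : y ≡ b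
      y≡b = ≤-antisym
        (right-end-≤ j<b (λ p q → A′⇒A (run h p q)) (right g))
        (right-end-≤ (<⇒≤ (lo<hi h)) (λ p q → run g (≤-trans (m≤n⇒m≤1+n a≤j) p) q) (λ Ay → right h (A⇒A′ Ay y≢j)))
    ... | no y≢j | no x≢1+j = inj₁ (h′ , λ { refl → ¬A′j (run h a≤j j<b) })
      where
      h′ : Gap A x y
      h′ = record
        { lo<hi = lo<hi h
        ; run   = λ p q → A′⇒A (run h p q)
        ; left  = λ { refl Ak → left h refl (A⇒A′ Ak (x≢1+j ∘ cong suc)) }
        ; right = λ Ay → right h (A⇒A′ Ay y≢j)
        }

    gap-keep : ∀ {x y} → Gap A x y → (x , y) ≢ (a , b) → Gap A′ x y
    gap-keep {x} {y} h ≢ab = record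
      { lo<hi = lo<hi h
      ; run   = λ p q → A⇒A′ (run h p q) λ { refl → j∉ p q }
      ; left  = λ p → left h p ∘ A′⇒A
      ; right = right h ∘ A′⇒A
      }
      where
      j∉ : x ≤ j → ¬ j < y
      j∉ x≤j j<y with refl , refl ← gap-unique g h a≤j j<b x≤j j<y = ≢ab refl

    gap-leftPart : a < j → Gap A′ a j
    gap-leftPart a<j = record
      { lo<hi = a<j
      ; run   = λ p q → A⇒A′ (run g p (<-trans q j<b)) (<⇒≢ q)
      ; left  = λ p → left g p ∘ A′⇒A
      ; right = ¬A′j
      }

    gap-rightPart : suc j < b → Gap A′ (suc j) b
    gap-rightPart 1+j<b = record
      { lo<hi = 1+j<b
      ; run   = λ p q → A⇒A′ (run g (≤-trans (m≤n⇒m≤1+n a≤j) p) q) (>⇒≢ p)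
      ; left  = λ { refl → ¬A′j }
      ; right = right g ∘ A′⇒A
      }

-- The intervals of a state, and their change when a payphone is taken

module _ {n : ℕ} where

  -- On all of ℕ, positions outside the row count as not vacant. So the right end `n` is a
  -- legitimate excluded bound, and the ends of the row stop a run just as occupied payphones do.
  Vacant : State n → ℕ → Set
  Vacant s k = ∃ λ i → toℕ i ≡ k × Available s i

  vacant? : ∀ s → Decidable (Vacant s)
  vacant? s k = Fin.any? (λ i → toℕ i ≟ k ×-dec Maybe.≡-dec _≟_ (lookup s i) nothing)

  vacant-< : ∀ s {k} → Vacant s k → k < n
  vacant-< s (i , refl , _) = Fin.toℕ<n i

  gap-hi≤n : ∀ s {a b} → Gap (Vacant s) a b → b ≤ n
  gap-hi≤n s {b = suc b} g = vacant-< s (run g (s≤s⁻¹ (lo<hi g)) ≤-refl)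

  opaque

    -- Kept opaque: outside this block only uniqueness and the two membership lemmas are visible,
    -- never the search through all pairs.
    gaps : State n → List (ℕ × ℕ)
    gaps s = filter (λ (a , b) → gap-dec (vacant? s) a b) (cartesianProduct (upTo n) (upTo (suc n)))

    gaps-unique : ∀ s → Unique (gaps s)
    gaps-unique s = Unique.filter⁺ _ (Unique.cartesianProduct⁺ (Unique.upTo⁺ n) (Unique.upTo⁺ (suc n)))

    ∈-gaps⁻ : ∀ s {a b} → (a , b) ∈ gaps s → Gap (Vacant s) a b
    ∈-gaps⁻ s = proj₂ ∘ ∈-filter⁻ _ {xs = cartesianProduct (upTo n) (upTo (suc n))}

    ∈-gaps⁺ : ∀ s {a b} → Gap (Vacant s) a b → (a , b) ∈ gaps s
    ∈-gaps⁺ s g = ∈-filter⁺ _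
      (∈-cartesianProduct⁺ (∈-upTo⁺ (vacant-< s (run g ≤-refl (lo<hi g)))) (∈-upTo⁺ (s≤s (gap-hi≤n s g)))) g

  otherGaps : State n → ℕ × ℕ → List (ℕ × ℕ)
  otherGaps s g = filter (λ x → ¬? (≡-dec _≟_ _≟_ x g)) (gaps s)

  module _ (s : State n) (j : Fin n) (p : ℕ) where

    private s′ = s [ j ]≔ just p

    available-update⁻ : ∀ i → Available s′ i → Available s i × i ≢ j
    available-update⁻ i av with i Fin.≟ j
    ... | yes refl with () ← trans (sym av) (Vec.lookup∘update i s (just p))
    ... | no i≢j = trans (sym (Vec.lookup∘update′ i≢j s (just p))) av , i≢j

    available-update⁺ : ∀ i → Available s i → i ≢ j → Available s′ i
    available-update⁺ i av i≢j = trans (Vec.lookup∘update′ i≢j s (just p)) av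

    -- Lists without repetition and with the same members are permutations of each other, so the
    -- order in which `gaps` lists the intervals never matters. The filter drops a part that is
    -- empty because `j` is an end of the interval.
    gaps-update : ∀ {a b} → Gap (Vacant s) a b → a ≤ toℕ j → toℕ j < b →
                  gaps s ↭ (a , b) ∷ otherGaps s (a , b) ×
                  gaps s′ ↭ filter (λ (x , y) → x <? y) ((a , toℕ j) ∷ (suc (toℕ j) , b) ∷ []) ++ otherGaps s (a , b)
    gaps-update {a} {b} g a≤j j<b = old↭ , new↭
      where
      rest? = λ x → ¬? (≡-dec _≟_ _≟_ x (a , b))
      rest = otherGaps s (a , b)
      part? = λ ((x , y) : ℕ × ℕ) → x <? y
      two = (a , toℕ j) ∷ (suc (toℕ j) , b) ∷ []
      parts = filter part? two

      V′⇒V : ∀ {k} → Vacant s′ k → Vacant s k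
      V′⇒V (i , eq , av) = i , eq , proj₁ (available-update⁻ i av)
      ¬V′j : ¬ Vacant s′ (toℕ j)
      ¬V′j (i , eq , av) = proj₂ (available-update⁻ i av) (Fin.toℕ-injective eq)
      V⇒V′ : ∀ {k} → Vacant s k → k ≢ toℕ j → Vacant s′ k
      V⇒V′ (i , refl , av) k≢j = i , refl , available-update⁺ i av (k≢j ∘ cong toℕ)

      ∈-rest⁻ : ∀ {x y} → (x , y) ∈ rest → Gap (Vacant s) x y × (x , y) ≢ (a , b)
      ∈-rest⁻ m with m′ , ≢ab ← ∈-filter⁻ rest? {xs = gaps s} m = ∈-gaps⁻ s m′ , ≢ab

      rest-unique : Unique rest
      rest-unique = Unique.filter⁺ rest? (gaps-unique s)

      old↭ : gaps s ↭ (a , b) ∷ rest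
      old↭ = ∼bag⇒↭ (unique∧set⇒bag (gaps-unique s)
        (All.tabulate (λ m ab≡ → proj₂ (∈-rest⁻ m) (sym ab≡)) ∷ rest-unique)
        (mk⇔ to from))
        where
        to : ∀ {x} → x ∈ gaps s → x ∈ (a , b) ∷ rest
        to {x} m with ≡-dec _≟_ _≟_ x (a , b)
        ... | yes refl = here refl
        ... | no  ≢ab  = there (∈-filter⁺ rest? m ≢ab)
        from : ∀ {x} → x ∈ (a , b) ∷ rest → x ∈ gaps s
        from (here refl) = ∈-gaps⁺ s g
        from (there m)   = proj₁ (∈-filter⁻ rest? m)

      new↭ : gaps s′ ↭ parts ++ rest
      new↭ = ∼bag⇒↭ (unique∧set⇒bag (gaps-unique s′)
        (Unique.++⁺ (Unique.filter⁺ part? {xs = two} (((λ eq → <⇒≢ (s≤s a≤j) (cong proj₁ eq)) ∷ []) ∷ [] ∷ []))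
          rest-unique disjoint)
        (mk⇔ to from))
        where
        -- Both parts border on `j`, which is vacant in `s`, so neither is a maximal run of `s`.
        disjoint : ∀ {x} → ¬ (x ∈ parts × x ∈ rest)
        disjoint (m , m′) with ∈-filter⁻ part? {xs = two} m
        ... | here refl , _         = right (proj₁ (∈-rest⁻ m′)) (run g a≤j j<b)
        ... | there (here refl) , _ = left (proj₁ (∈-rest⁻ m′)) refl (run g a≤j j<b)
        to : ∀ {x} → x ∈ gaps s′ → x ∈ parts ++ rest
        to m with gap-split V′⇒V ¬V′j V⇒V′ g a≤j j<b (∈-gaps⁻ s′ m)
        ... | inj₁ (h , ≢ab)         = ∈-++⁺ʳ parts (∈-filter⁺ rest? (∈-gaps⁺ s h) ≢ab)
        ... | inj₂ (inj₁ (refl , lt)) = ∈-++⁺ˡ (∈-filter⁺ part? {xs = two} (here refl) lt)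
        ... | inj₂ (inj₂ (refl , lt)) = ∈-++⁺ˡ (∈-filter⁺ part? {xs = two} (there (here refl)) lt)
        from : ∀ {x} → x ∈ parts ++ rest → x ∈ gaps s′
        from m with ∈-++⁻ parts m
        ... | inj₂ m′ with h , ≢ab ← ∈-rest⁻ m′ =
          ∈-gaps⁺ s′ (gap-keep V′⇒V ¬V′j V⇒V′ g a≤j j<b h ≢ab)
        from m | inj₁ m′ with ∈-filter⁻ part? {xs = two} m′
        ... | here refl , lt         = ∈-gaps⁺ s′ (gap-leftPart V′⇒V ¬V′j V⇒V′ g a≤j j<b lt)
        ... | there (here refl) , lt = ∈-gaps⁺ s′ (gap-rightPart V′⇒V ¬V′j V⇒V′ g a≤j j<b lt)

-- Splitting a single interval

-- The list form of the middles has the right length and no repetition; the rounded form is the one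
-- in which `S` recurses.
∈-halves⁻ : ∀ m {x} → x ∈ halves m → x ≡ ⌊ m /2⌋ ⊎ x ≡ ⌈ m /2⌉
∈-halves⁻ 0 (here refl) = inj₁ refl
∈-halves⁻ 1 (here refl) = inj₁ refl
∈-halves⁻ 1 (there (here refl)) = inj₂ refl
∈-halves⁻ (suc (suc m)) x∈ with ∈-map⁻ suc x∈
... | y , y∈ , refl with ∈-halves⁻ m y∈
...   | inj₁ eq = inj₁ (cong suc eq)
...   | inj₂ eq = inj₂ (cong suc eq)

∈-halves⁺ : ∀ m {x} → x ≡ ⌊ m /2⌋ ⊎ x ≡ ⌈ m /2⌉ → x ∈ halves m
∈-halves⁺ 0 (inj₁ refl) = here refl
∈-halves⁺ 0 (inj₂ refl) = here refl
∈-halves⁺ 1 (inj₁ refl) = here refl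
∈-halves⁺ 1 (inj₂ refl) = there (here refl)
∈-halves⁺ (suc (suc m)) (inj₁ refl) = ∈-map⁺ suc (∈-halves⁺ m (inj₁ refl))
∈-halves⁺ (suc (suc m)) (inj₂ refl) = ∈-map⁺ suc (∈-halves⁺ m (inj₂ refl))

halves-unique : ∀ m → Unique (halves m)
halves-unique 0             = [] ∷ []
halves-unique 1             = ((λ ()) ∷ []) ∷ [] ∷ []
halves-unique (suc (suc m)) = Unique.map⁺ suc-injective (halves-unique m)

n∸⌊n/2⌋≡⌈n/2⌉ : ∀ n → n ∸ ⌊ n /2⌋ ≡ ⌈ n /2⌉
n∸⌊n/2⌋≡⌈n/2⌉ n = trans (cong (_∸ ⌊ n /2⌋) (sym (⌊n/2⌋+⌈n/2⌉≡n n))) (m+n∸m≡n ⌊ n /2⌋ ⌈ n /2⌉)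

n∸⌈n/2⌉≡⌊n/2⌋ : ∀ n → n ∸ ⌈ n /2⌉ ≡ ⌊ n /2⌋
n∸⌈n/2⌉≡⌊n/2⌋ n = trans (cong (_∸ ⌈ n /2⌉) (sym (⌊n/2⌋+⌈n/2⌉≡n n))) (m+n∸n≡m ⌊ n /2⌋ ⌈ n /2⌉)

⌊/2⌋-max : ∀ {x} m → x + x ≤ m → x ≤ ⌊ m /2⌋
⌊/2⌋-max {x} m x+x≤m = subst (_≤ ⌊ m /2⌋) (sym (n≡⌊n+n/2⌋ x)) (⌊n/2⌋-mono x+x≤m)

-- `atStart` and `atEnd` stand for semi-closed intervals at the left and right end of the row,
-- `inner` for closed ones.
data Kind : Set where
  atStart atEnd inner : Kind

fullLength : Kind → ℕ → ℕ
fullLength atStart ℓ = 2 * ℓ ∸ 1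
fullLength atEnd   ℓ = 2 * ℓ ∸ 1
fullLength inner   ℓ = ℓ

-- The full lengths of the interval and of all intervals that later arise in it.
descendants : Kind → ℕ → Multiset
descendants atStart = S'
descendants atEnd   = S'
descendants inner   = S

-- Payphones in an interval are given by their offset from its left end.
distance : Kind → ℕ → ℕ → ℕ
distance atStart ℓ x = ℓ ∸ x
distance atEnd   ℓ x = suc x
distance inner   ℓ x = suc x ⊓ (ℓ ∸ x)

farthest : Kind → ℕ → List ℕ
farthest _       zero    = []
farthest atStart (suc m) = 0 ∷ []
farthest atEnd   (suc m) = m ∷ []
farthest inner   (suc m) = halves m

farthest-unique : ∀ κ ℓ → Unique (farthest κ ℓ)
farthest-unique atStart zero    = []
farthest-unique atEnd   zero    = []
farthest-unique inner   zero    = []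
farthest-unique atStart (suc m) = [] ∷ []
farthest-unique atEnd   (suc m) = [] ∷ []
farthest-unique inner   (suc m) = halves-unique m

∈-farthest-< : ∀ κ ℓ {x} → x ∈ farthest κ ℓ → x < ℓ
∈-farthest-< atStart (suc m) (here refl) = s≤s z≤n
∈-farthest-< atEnd   (suc m) (here refl) = ≤-refl
∈-farthest-< inner   (suc m) x∈ with ∈-halves⁻ m x∈
... | inj₁ refl = s≤s (⌊n/2⌋≤n m)
... | inj₂ refl = s≤s (⌈n/2⌉≤n m)

-- In a closed interval of length `suc m` the offset `x` has distance 1 + min(x, m - x). Comparison
-- with the offset `⌊ m /2⌋` shows that this minimum is at least `⌊ m /2⌋`; it cannot be larger,
-- since twice it is at most m. So x or m - x equals `⌊ m /2⌋`.
∈-farthest⁺ : ∀ κ {ℓ x} → x < ℓ → (∀ {y} → y < ℓ → distance κ ℓ y ≤ distance κ ℓ x) → x ∈ farthest κ ℓ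
∈-farthest⁺ atStart {suc m} {zero}  x<ℓ max = here refl
∈-farthest⁺ atStart {suc m} {suc x} x<ℓ max = contradiction (max (s≤s z≤n)) (<⇒≱ (s≤s (m∸n≤m m x)))
∈-farthest⁺ atEnd   {suc m} {x}     x<ℓ max = here (≤-antisym (s≤s⁻¹ x<ℓ) (s≤s⁻¹ (max ≤-refl)))
∈-farthest⁺ inner   {suc m} {x}     x<ℓ max = ∈-halves⁺ m cases
  where
  x≤m = s≤s⁻¹ x<ℓ
  h = ⌊ m /2⌋
  h≤x⊓m∸x : h ≤ x ⊓ (m ∸ x)
  h≤x⊓m∸x = s≤s⁻¹ (begin
    suc h                     ≤⟨ ⊓-glb ≤-refl (s≤s (⌊n/2⌋≤⌈n/2⌉ m)) ⟩
    suc h ⊓ suc ⌈ m /2⌉       ≡⟨ cong (suc h ⊓_) (cong suc (sym (n∸⌊n/2⌋≡⌈n/2⌉ m))) ⟩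
    suc h ⊓ suc (m ∸ h)       ≡⟨ cong (suc h ⊓_) (sym (+-∸-assoc 1 (⌊n/2⌋≤n m))) ⟩
    suc h ⊓ (suc m ∸ h)       ≤⟨ max (s≤s (⌊n/2⌋≤n m)) ⟩
    suc x ⊓ (suc m ∸ x)       ≡⟨ cong (suc x ⊓_) (+-∸-assoc 1 x≤m) ⟩
    suc (x ⊓ (m ∸ x))         ∎)
    where open ≤-Reasoning
  cases : x ≡ ⌊ m /2⌋ ⊎ x ≡ ⌈ m /2⌉
  cases with ≤-total x (m ∸ x)
  ... | inj₁ x≤m∸x = inj₁ (≤-antisym
    (⌊/2⌋-max m (≤-trans (+-monoʳ-≤ x x≤m∸x) (≤-reflexive (m+[n∸m]≡n x≤m))))
    (≤-trans h≤x⊓m∸x (m⊓n≤m x _)))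
  ... | inj₂ m∸x≤x = inj₂ (trans (sym (m∸[m∸n]≡n x≤m)) (trans (cong (m ∸_) m∸x≡h) (n∸⌊n/2⌋≡⌈n/2⌉ m)))
    where
    m∸x≡h : m ∸ x ≡ h
    m∸x≡h = ≤-antisym
      (⌊/2⌋-max m (≤-trans (+-monoˡ-≤ (m ∸ x) m∸x≤x) (≤-reflexive (m+[n∸m]≡n x≤m))))
      (≤-trans h≤x⊓m∸x (m⊓n≤n x _))

-- For a closed interval: twice the minimum of y and m - y is at most their sum m, so no offset has
-- distance above `suc ⌊ m /2⌋`, and both middles attain it.
∈-farthest⁻ : ∀ κ ℓ {x y} → x ∈ farthest κ ℓ → y < ℓ → distance κ ℓ y ≤ distance κ ℓ x
∈-farthest⁻ atStart (suc m) {y = y} (here refl) _ = m∸n≤m (suc m) y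
∈-farthest⁻ atEnd   (suc m) (here refl) y<ℓ = y<ℓ
∈-farthest⁻ inner   (suc m) {x} {y} x∈ y<ℓ = begin
  suc y ⊓ (suc m ∸ y)   ≡⟨ cong (suc y ⊓_) (+-∸-assoc 1 y≤m) ⟩
  suc (y ⊓ (m ∸ y))     ≤⟨ s≤s (⌊/2⌋-max m (≤-trans (+-mono-≤ (m⊓n≤m y _) (m⊓n≤n y _)) (≤-reflexive (m+[n∸m]≡n y≤m)))) ⟩
  suc ⌊ m /2⌋           ≤⟨ half (∈-halves⁻ m x∈) ⟩
  suc x ⊓ (suc m ∸ x)   ∎
  where
  open ≤-Reasoning
  y≤m = s≤s⁻¹ y<ℓ
  half : ∀ {x} → x ≡ ⌊ m /2⌋ ⊎ x ≡ ⌈ m /2⌉ → suc ⌊ m /2⌋ ≤ suc x ⊓ (suc m ∸ x)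
  half (inj₁ refl) = ⊓-glb ≤-refl (≤-trans (s≤s (⌊n/2⌋≤⌈n/2⌉ m))
    (≤-reflexive (sym (trans (+-∸-assoc 1 (⌊n/2⌋≤n m)) (cong suc (n∸⌊n/2⌋≡⌈n/2⌉ m))))))
  half (inj₂ refl) = ⊓-glb (s≤s (⌊n/2⌋≤⌈n/2⌉ m))
    (≤-reflexive (sym (trans (+-∸-assoc 1 (⌈n/2⌉≤n m)) (cong suc (n∸⌈n/2⌉≡⌊n/2⌋ m)))))

fullLength-pos : ∀ κ {ℓ} → 0 < ℓ → 0 < fullLength κ ℓ
fullLength-pos atStart {suc m} _ = subst (0 <_) (sym (+-suc m _)) (s≤s z≤n)
fullLength-pos atEnd   {suc m} _ = subst (0 <_) (sym (+-suc m _)) (s≤s z≤n)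
fullLength-pos inner   ℓ>0 = ℓ>0

middles-odd : ∀ m {L} → 2 * suc m ∸ 1 ≡ suc L → middles L ≡ 1
middles-odd m {L} eq with middles-parity L
... | inj₂ (_ , one)      = one
... | inj₁ (k , even , _) = contradiction (trans (sym (trans eq even)) (+-suc m _)) (even≢odd (suc k) m)

-- One factor serves all kinds: a semi-closed interval has one farthest payphone, and its full
-- length is odd.
length-farthest : ∀ κ {ℓ L} → 0 < ℓ → fullLength κ ℓ ≡ suc L → length (farthest κ ℓ) ≡ middles L
length-farthest atStart {suc m} _ eq   = sym (middles-odd m eq)
length-farthest atEnd   {suc m} _ eq   = sym (middles-odd m eq)
length-farthest inner   {suc m} _ refl = refl

maximum-++ : ∀ M {N k} → maximum M ≤ k → maximum N ≤ k → maximum (M ∪ N) ≤ k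
maximum-++ []      _ q = q
maximum-++ (x ∷ M) p q = ⊔-lub (m⊔n≤o⇒m≤o x _ p) (maximum-++ M (m⊔n≤o⇒n≤o x _ p) q)

#-++ : ∀ k M N → # k (M ∪ N) ≡ # k M + # k N
#-++ k M N = trans (cong length (filter-++ (k ≟_) M N)) (length-++ (filter (k ≟_) M))

maximum-S : ∀ n → maximum (S n) ≤ n
maximum-S = <-rec _ step
  where
  step : ∀ n → (∀ {m} → m < n → maximum (S m) ≤ m) → maximum (S n) ≤ n
  step zero    rec = z≤n
  step (suc m) rec = subst (λ M → maximum M ≤ suc m) (sym (S-suc m)) (⊔-lub ≤-refl (maximum-++ (S ⌊ m /2⌋)
    (≤-trans (rec (s≤s (⌊n/2⌋≤n m))) (m≤n⇒m≤1+n (⌊n/2⌋≤n m)))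
    (≤-trans (rec (s≤s (⌈n/2⌉≤n m))) (m≤n⇒m≤1+n (⌈n/2⌉≤n m)))))

-- For the rounded-up middle the two halves change places, hence a permutation.
descendants-inner : ∀ m {x} → x ∈ halves m → S (suc m) ↭ suc m ∷ S x ∪ S (m ∸ x)
descendants-inner m x∈ = ↭-trans (↭-reflexive (S-suc m)) (↭-prep (suc m) (split (∈-halves⁻ m x∈)))
  where
  split : ∀ {x} → x ≡ ⌊ m /2⌋ ⊎ x ≡ ⌈ m /2⌉ → S ⌊ m /2⌋ ∪ S ⌈ m /2⌉ ↭ S x ∪ S (m ∸ x)
  split (inj₁ refl) = ↭-reflexive (cong (λ y → S ⌊ m /2⌋ ∪ S y) (sym (n∸⌊n/2⌋≡⌈n/2⌉ m)))
  split (inj₂ refl) = ↭-trans (++-comm (S ⌊ m /2⌋) (S ⌈ m /2⌉))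
    (↭-reflexive (cong (λ y → S ⌈ m /2⌉ ∪ S y) (sym (n∸⌈n/2⌉≡⌊n/2⌋ m))))

maximum-S' : ∀ ℓ → maximum (S' ℓ) ≤ 2 * ℓ ∸ 1
maximum-S' zero    = z≤n
maximum-S' (suc m) = maximum-++ (S m) (≤-trans (maximum-S m) (m≤m+n m _)) (⊔-lub ≤-refl z≤n)

maximum-descendants : ∀ κ ℓ → maximum (descendants κ ℓ) ≤ fullLength κ ℓ
maximum-descendants atStart = maximum-S'
maximum-descendants atEnd   = maximum-S'
maximum-descendants inner   = maximum-S

#-S' : ∀ m → # (2 * suc m ∸ 1) (S' (suc m)) ≡ 1
#-S' m = begin
  # L (S m ∪ (L ∷ []))           ≡⟨ #-++ L (S m) (L ∷ []) ⟩
  # L (S m) + # L (L ∷ [])       ≡⟨ cong₂ _+_ (#-> (S m) m<L) (#-∷-≡ L []) ⟩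
  1                              ∎
  where
  open ≡-Reasoning
  L = 2 * suc m ∸ 1
  m<L : maximum (S m) < L
  m<L = ≤-trans (s≤s (maximum-S m)) (≤-trans (m≤m+n (suc m) _) (≤-reflexive (sym (+-suc m _))))

#-descendants : ∀ κ {ℓ} → 0 < ℓ → # (fullLength κ ℓ) (descendants κ ℓ) ≡ 1
#-descendants atStart {suc m} _ = #-S' m
#-descendants atEnd   {suc m} _ = #-S' m
#-descendants inner   {suc m} _ = begin
  # L (S (suc m))                           ≡⟨ cong (# L) (S-suc m) ⟩
  # L (L ∷ S ⌊ m /2⌋ ∪ S ⌈ m /2⌉)           ≡⟨ #-∷-≡ L _ ⟩
  suc (# L (S ⌊ m /2⌋ ∪ S ⌈ m /2⌉))         ≡⟨ cong suc (#-> (S ⌊ m /2⌋ ∪ S ⌈ m /2⌉) (s≤s (maximum-++ (S ⌊ m /2⌋)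
                                                (≤-trans (maximum-S _) (⌊n/2⌋≤n m))
                                                (≤-trans (maximum-S _) (⌈n/2⌉≤n m))))) ⟩
  1                                         ∎
  where
  open ≡-Reasoning
  L = suc m

farthest-nonempty : ∀ κ {ℓ} → 0 < ℓ → ∃ (_∈ farthest κ ℓ)
farthest-nonempty atStart {suc m} _ = 0 , here refl
farthest-nonempty atEnd   {suc m} _ = m , here refl
farthest-nonempty inner   {suc m} _ = ⌊ m /2⌋ , ∈-halves⁺ m (inj₁ refl)

-- Splitting within a state

module _ {A B : Set} where

  concatMap-↭ : ∀ (f : A → List B) {xs ys} → xs ↭ ys → concatMap f xs ↭ concatMap f ys
  concatMap-↭ f Perm.refl          = ↭-refl
  concatMap-↭ f (Perm.prep x p)    = ++⁺ˡ (f x) (concatMap-↭ f p)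
  concatMap-↭ f (Perm.swap x y p)  = ↭-trans (shifts (f x) (f y)) (++⁺ˡ (f y) (++⁺ˡ (f x) (concatMap-↭ f p)))
  concatMap-↭ f (Perm.trans p q)   = ↭-trans (concatMap-↭ f p) (concatMap-↭ f q)

  concatMap-filter : ∀ (f : A → List B) {P : A → Set} (P? : Decidable P) → (∀ {x} → ¬ P x → f x ≡ []) →
                     ∀ xs → concatMap f (filter P? xs) ≡ concatMap f xs
  concatMap-filter f P? f≡[] []       = refl
  concatMap-filter f P? f≡[] (x ∷ xs) with P? x
  ... | yes _  = cong (f x ++_) (concatMap-filter f P? f≡[] xs)
  ... | no ¬Px = trans (concatMap-filter f P? f≡[] xs) (cong (_++ concatMap f xs) (sym (f≡[] ¬Px)))

  ∈-concatMap⁻′ : ∀ (f : A → List B) {xs y} → y ∈ concatMap f xs → ∃ λ x → x ∈ xs × y ∈ f x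
  ∈-concatMap⁻′ f {xs} = find ∘ ∈-concatMap⁻ f {xs = xs}

  ∈-concatMap⁺′ : ∀ (f : A → List B) {xs x y} → x ∈ xs → y ∈ f x → y ∈ concatMap f xs
  ∈-concatMap⁺′ f x∈ y∈ = ∈-concatMap⁺ f (lose x∈ y∈)

  concatMap-unique : ∀ {f : A → List B} {xs} → Unique xs → (∀ {x} → x ∈ xs → Unique (f x)) →
                     (∀ {x y z} → x ∈ xs → y ∈ xs → z ∈ f x → z ∈ f y → x ≡ y) → Unique (concatMap f xs)
  concatMap-unique []       _ _ = []
  concatMap-unique {f} (x∉ ∷ u) uf sep = Unique.++⁺ (uf (here refl))
    (concatMap-unique u (uf ∘ there) (λ m m′ → sep (there m) (there m′)))
    λ { (z∈fx , z∈) → let _ , y∈ , z∈fy = ∈-concatMap⁻′ f z∈ in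
        All.lookup x∉ y∈ (sep (here refl) (there y∈) z∈fx z∈fy) }

≤-maximum : ∀ {M k} → k ∈ M → k ≤ maximum M
≤-maximum (here refl) = m≤m⊔n _ _
≤-maximum (there k∈)  = ≤-trans (≤-maximum k∈) (m≤n⊔m _ _)

maximum-≤ : ∀ {M k} → (∀ {i} → i ∈ M → i ≤ k) → maximum M ≤ k
maximum-≤ {[]}    _ = z≤n
maximum-≤ {x ∷ M} p = ⊔-lub (p (here refl)) (maximum-≤ (p ∘ there))

-- A fold of `_⊔_` returns an entry or the default 0; the positive entry `k` rules out the default.
maximum-∈ : ∀ {M k} → k ∈ M → 0 < k → maximum M ∈ M
maximum-∈ {M} k∈ k>0 with foldr-selective ⊔-sel 0 M
... | inj₁ eq  = contradiction (≤-trans (≤-maximum k∈) (≤-reflexive eq)) (<⇒≱ k>0)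
... | inj₂ max = max

-- Pending full lengths and available choices of a state

module _ (n : ℕ) where

  -- Only an empty row has an interval with both a ≡ 0 and b ≡ n.
  kind : ℕ → ℕ → Kind
  kind a b with a ≟ 0 | b ≟ n
  ... | yes _ | _     = atStart
  ... | no _  | yes _ = atEnd
  ... | no _  | no _  = inner

  kind-atEnd : ∀ {a} → a ≢ 0 → kind a n ≡ atEnd
  kind-atEnd {a} a≢0 with a ≟ 0 | n ≟ n
  ... | yes a≡0 | _       = contradiction a≡0 a≢0
  ... | no _    | yes _   = refl
  ... | no _    | no n≢n  = contradiction refl n≢n

  kind-inner : ∀ {a b} → a ≢ 0 → b ≢ n → kind a b ≡ inner
  kind-inner {a} {b} a≢0 b≢n with a ≟ 0 | b ≟ n
  ... | yes a≡0 | _       = contradiction a≡0 a≢0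
  ... | no _    | yes b≡n = contradiction b≡n b≢n
  ... | no _    | no _    = refl

  -- `kind` answers `atStart` without a look at `b`. The view supplies `b ≢ n` as well, so that
  -- matching on it reveals both flanks.
  data KindView (a b : ℕ) : Kind → Set where
    atStart : a ≡ 0 → b ≢ n → KindView a b atStart
    atEnd   : a ≢ 0 → b ≡ n → KindView a b atEnd
    inner   : a ≢ 0 → b ≢ n → KindView a b inner

  kindView : ∀ {a b} → ¬ (a ≡ 0 × b ≡ n) → KindView a b (kind a b)
  kindView {a} {b} ¬all with a ≟ 0 | b ≟ n
  ... | yes a≡0 | b≟n     = atStart a≡0 (¬all ∘ (a≡0 ,_))
  ... | no a≢0  | yes b≡n = atEnd a≢0 b≡n
  ... | no a≢0  | no b≢n  = inner a≢0 b≢n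

  gapLength : ℕ × ℕ → ℕ
  gapLength (a , b) = fullLength (kind a b) (b ∸ a)

  gapDescendants : ℕ × ℕ → Multiset
  gapDescendants (a , b) = descendants (kind a b) (b ∸ a)

  gapFarthest : ℕ × ℕ → List ℕ
  gapFarthest (a , b) = map (a +_) (farthest (kind a b) (b ∸ a))

  gapDescendants-inner : ∀ {a b} → a ≢ 0 → b ≢ n → gapDescendants (a , b) ≡ S (b ∸ a)
  gapDescendants-inner {a} {b} a≢0 b≢n = cong (λ κ → descendants κ (b ∸ a)) (kind-inner a≢0 b≢n)

  gapDescendants-atEnd : ∀ {a} → a ≢ 0 → gapDescendants (a , n) ≡ S' (n ∸ a)
  gapDescendants-atEnd {a} a≢0 = cong (λ κ → descendants κ (n ∸ a)) (kind-atEnd a≢0)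

  gapDescendants-empty : ∀ {x y} → ¬ x < y → gapDescendants (x , y) ≡ []
  gapDescendants-empty {x} {y} x≮y = trans (cong (descendants κ) (m≤n⇒m∸n≡0 (≮⇒≥ x≮y))) (none κ)
    where
    κ = kind x y
    none : ∀ κ → descendants κ 0 ≡ []
    none atStart = refl
    none atEnd   = refl
    none inner   = refl

  private
    -- At an end of the row the end payphone is taken: one part is empty and the other is closed of
    -- length `m`, which gives `S m`. In a closed interval both parts are closed.
    split : ∀ {κ} a ℓ x → KindView a (a + ℓ) κ → a + ℓ ≤ n → x ∈ farthest κ ℓ →
            descendants κ ℓ ↭ fullLength κ ℓ ∷ gapDescendants (a , a + x) ∪ gapDescendants (suc (a + x) , a + ℓ)
    split a (suc m) _ (atStart refl b≢n) _ (here refl) = ↭-trans (↭-sym (∷↭∷ʳ (2 * suc m ∸ 1) (S m)))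
      (↭-reflexive (cong (2 * suc m ∸ 1 ∷_) (sym (gapDescendants-inner {1} 1+n≢0 b≢n))))
    split a (suc m) x (atEnd a≢0 b≡n) b≤n (here refl) = ↭-trans (↭-sym (∷↭∷ʳ (2 * suc m ∸ 1) (S m)))
      (↭-reflexive (cong (2 * suc m ∸ 1 ∷_) (begin
        S m       ≡⟨ ++-identityʳ (S m) ⟨
        S m ∪ []  ≡⟨ cong₂ _∪_ (trans (cong S (sym (m+n∸m≡n a m)))
                       (sym (gapDescendants-inner a≢0 (<⇒≢ (<-≤-trans (+-monoʳ-< a (n<1+n m)) b≤n)))))
                       (sym (gapDescendants-empty (≤⇒≯ (≤-reflexive (+-suc a m))))) ⟩
        gapDescendants (a , a + m) ∪ gapDescendants (suc (a + m) , a + suc m) ∎)))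
      where open ≡-Reasoning
    split a (suc m) x (inner a≢0 b≢n) b≤n x∈ = ↭-trans (descendants-inner m x∈)
      (↭-reflexive (cong (suc m ∷_) (cong₂ _∪_
        (trans (cong S (sym (m+n∸m≡n a x)))
          (sym (gapDescendants-inner a≢0 (<⇒≢ (<-≤-trans (+-monoʳ-< a (∈-farthest-< inner (suc m) x∈)) b≤n)))))
        (trans (cong S (sym (trans (cong (_∸ suc (a + x)) (+-suc a m)) ([m+n]∸[m+o]≡n∸o a m x))))
          (sym (gapDescendants-inner 1+n≢0 b≢n))))))

  gapDescendants-split : ∀ {a b j} → a ≤ b → b ≤ n → ¬ (a ≡ 0 × b ≡ n) → j ∈ gapFarthest (a , b) →
    gapDescendants (a , b) ↭ gapLength (a , b) ∷ gapDescendants (a , j) ∪ gapDescendants (suc j , b)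
  gapDescendants-split {a} {b} a≤b b≤n ¬all j∈
    -- Writing `b` as `a + ℓ` makes the length a variable on which `split` can match.
    with ℓ ← b ∸ a in eq
    with refl ← trans (sym (m+[n∸m]≡n a≤b)) (cong (a +_) eq)
    with x , x∈ , refl ← ∈-map⁻ (a +_) j∈ =
    split a ℓ x (kindView ¬all) b≤n x∈

  module _ (L : ℕ) where

    longest? : Decidable (λ g → gapLength g ≡ suc L)
    longest? g = gapLength g ≟ suc L

    -- An interval of full length `suc L` offers `middles L` payphones and contributes `suc L` to
    -- the multiset exactly once. A shorter interval offers nothing, and nothing arising in it
    -- reaches `suc L`.
    length-farthest-longest : ∀ gs → All (λ (a , b) → a < b) gs → All (λ g → gapLength g ≤ suc L) gs →
      length (concatMap gapFarthest (filter longest? gs)) ≡ # (suc L) (concatMap gapDescendants gs) * middles L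
    length-farthest-longest []             _            _              = refl
    length-farthest-longest ((a , b) ∷ gs) (a<b ∷ gs<) (g≤ ∷ gs≤)
      with ih ← length-farthest-longest gs gs< gs≤ | gapLength (a , b) ≟ suc L
    ... | yes eq = begin
      length (concatMap gapFarthest (filter longest? ((a , b) ∷ gs)))
        ≡⟨ cong (length ∘ concatMap gapFarthest) (filter-accept longest? {a , b} {gs} eq) ⟩
      length (gapFarthest (a , b) ++ concatMap gapFarthest (filter longest? gs))
        ≡⟨ length-++ (gapFarthest (a , b)) ⟩
      length (gapFarthest (a , b)) + length (concatMap gapFarthest (filter longest? gs))
        ≡⟨ cong₂ _+_ (trans (length-map (a +_) (farthest (kind a b) (b ∸ a)))
                          (length-farthest (kind a b) (m<n⇒0<n∸m a<b) eq)) ih ⟩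
      suc (# (suc L) (concatMap gapDescendants gs)) * middles L
        ≡⟨ cong (λ k → (k + # (suc L) (concatMap gapDescendants gs)) * middles L)
             (trans (sym (#-descendants (kind a b) (m<n⇒0<n∸m a<b)))
                    (cong (λ k → # k (gapDescendants (a , b))) eq)) ⟩
      (# (suc L) (gapDescendants (a , b)) + # (suc L) (concatMap gapDescendants gs)) * middles L
        ≡⟨ cong (_* middles L) (sym (#-++ (suc L) (gapDescendants (a , b)) _)) ⟩
      # (suc L) (gapDescendants (a , b) ∪ concatMap gapDescendants gs) * middles L ∎
      where open ≡-Reasoning
    ... | no neq = begin
      length (concatMap gapFarthest (filter longest? ((a , b) ∷ gs)))
        ≡⟨ cong (length ∘ concatMap gapFarthest) (filter-reject longest? {a , b} {gs} neq) ⟩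
      length (concatMap gapFarthest (filter longest? gs))
        ≡⟨ ih ⟩
      # (suc L) (concatMap gapDescendants gs) * middles L
        ≡⟨ cong (λ k → (k + # (suc L) (concatMap gapDescendants gs)) * middles L) (sym
             (#-> (gapDescendants (a , b)) (≤-<-trans (maximum-descendants (kind a b) _) (≤∧≢⇒< g≤ neq)))) ⟩
      (# (suc L) (gapDescendants (a , b)) + # (suc L) (concatMap gapDescendants gs)) * middles L
        ≡⟨ cong (_* middles L) (sym (#-++ (suc L) (gapDescendants (a , b)) _)) ⟩
      # (suc L) (gapDescendants (a , b) ∪ concatMap gapDescendants gs) * middles L ∎
      where open ≡-Reasoning

  ∈-gapFarthest⁻ : ∀ {a b j} → a ≤ b → j ∈ gapFarthest (a , b) → a ≤ j × j < b × j ∸ a ∈ farthest (kind a b) (b ∸ a)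
  ∈-gapFarthest⁻ {a} {b} a≤b j∈ with x , x∈ , refl ← ∈-map⁻ (a +_) j∈ =
    m≤m+n a x ,
    <-≤-trans (+-monoʳ-< a (∈-farthest-< (kind a b) (b ∸ a) x∈)) (≤-reflexive (m+[n∸m]≡n a≤b)) ,
    subst (_∈ farthest (kind a b) (b ∸ a)) (sym (m+n∸m≡n a x)) x∈

  pending : State n → Multiset
  pending s = concatMap gapDescendants (gaps s)

  greatest : State n → ℕ
  greatest s = maximum (map gapLength (gaps s))

  opaque

    choices : State n → List ℕ
    choices s = concatMap gapFarthest (filter (λ g → gapLength g ≟ greatest s) (gaps s))

  module _ (s : State n) where

    gapLength≤greatest : ∀ {a b} → Gap (Vacant s) a b → gapLength (a , b) ≤ greatest s
    gapLength≤greatest g = ≤-maximum (∈-map⁺ gapLength (∈-gaps⁺ s g))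

    opaque
      unfolding choices

      ∈-choices⁻ : ∀ {j} → j ∈ choices s →
                   ∃ λ a → ∃ λ b → Gap (Vacant s) a b × gapLength (a , b) ≡ greatest s × j ∈ gapFarthest (a , b)
      ∈-choices⁻ j∈ with (a , b) , g∈ , j∈g ← ∈-concatMap⁻′ gapFarthest j∈
        with g∈gaps , eq ← ∈-filter⁻ (λ g → gapLength g ≟ greatest s) {xs = gaps s} g∈ =
        a , b , ∈-gaps⁻ s g∈gaps , eq , j∈g

      ∈-choices⁺ : ∀ {a b j} → Gap (Vacant s) a b → gapLength (a , b) ≡ greatest s →
                   j ∈ gapFarthest (a , b) → j ∈ choices s
      ∈-choices⁺ g eq = ∈-concatMap⁺′ gapFarthest (∈-filter⁺ (λ g → gapLength g ≟ greatest s) (∈-gaps⁺ s g) eq)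

      choices-unique : Unique (choices s)
      choices-unique = concatMap-unique (Unique.filter⁺ _ (gaps-unique s))
        (λ {(a , b)} _ → Unique.map⁺ (+-cancelˡ-≡ a _ _) (farthest-unique (kind a b) (b ∸ a)))
        sep
        where
        sep : ∀ {x y z} → x ∈ filter (λ g → gapLength g ≟ greatest s) (gaps s) →
              y ∈ filter (λ g → gapLength g ≟ greatest s) (gaps s) →
              z ∈ gapFarthest x → z ∈ gapFarthest y → x ≡ y
        sep x∈ y∈ z∈x z∈y
          with g ← ∈-gaps⁻ s (proj₁ (∈-filter⁻ (λ g → gapLength g ≟ greatest s) x∈))
             | h ← ∈-gaps⁻ s (proj₁ (∈-filter⁻ (λ g → gapLength g ≟ greatest s) y∈))
          with p , q , _ ← ∈-gapFarthest⁻ (<⇒≤ (lo<hi g)) z∈x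
             | p′ , q′ , _ ← ∈-gapFarthest⁻ (<⇒≤ (lo<hi h)) z∈y
          with refl , refl ← gap-unique g h p q p′ q′ = refl

      length-choices : ∀ {L} → greatest s ≡ suc L → length (choices s) ≡ # (suc L) (pending s) * middles L
      length-choices {L} eq =
        trans (cong (λ k → length (concatMap gapFarthest (filter (λ g → gapLength g ≟ k) (gaps s)))) eq)
          (length-farthest-longest L (gaps s)
            (All.tabulate (λ m → lo<hi (∈-gaps⁻ s m)))
            (All.tabulate (λ m → ≤-trans (≤-maximum (∈-map⁺ gapLength m)) (≤-reflexive eq))))

    -- The interval around a vacant payphone has positive full length, so `greatest s` is not merely
    -- the default 0 of an empty list.
    greatest-attained : ∀ {k} → Vacant s k →
      0 < greatest s × ∃ λ a → ∃ λ b → Gap (Vacant s) a b × gapLength (a , b) ≡ greatest s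
    greatest-attained v with a , b , g , _ ← gap-around (vacant? s) (vacant-< s) v
      with pos ← fullLength-pos (kind a b) (m<n⇒0<n∸m (lo<hi g))
      with (x , y) , m , eq ← ∈-map⁻ gapLength (maximum-∈ (∈-map⁺ gapLength (∈-gaps⁺ s g)) pos) =
      <-≤-trans pos (gapLength≤greatest g) , x , y , ∈-gaps⁻ s m , sym eq

    -- Nothing is assumed about how `j` was chosen, so this covers the first person too, who splits
    -- the whole row.
    pending-update : ∀ (j : Fin n) p {a b} → Gap (Vacant s) a b → a ≤ toℕ j → toℕ j < b →
      pending s ↭ gapDescendants (a , b) ∪ concatMap gapDescendants (otherGaps s (a , b)) ×
      pending (s [ j ]≔ just p) ↭ (gapDescendants (a , toℕ j) ∪ gapDescendants (suc (toℕ j) , b)) ∪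
                                  concatMap gapDescendants (otherGaps s (a , b))
    pending-update j p {a} {b} g a≤j j<b with old↭ , new↭ ← gaps-update s j p g a≤j j<b =
      concatMap-↭ gapDescendants old↭ ,
      ↭-trans (concatMap-↭ gapDescendants new↭) (↭-reflexive (begin
        concatMap gapDescendants (filter part? two ++ rest)
          ≡⟨ concatMap-++ gapDescendants (filter part? two) rest ⟩
        concatMap gapDescendants (filter part? two) ++ concatMap gapDescendants rest
          ≡⟨ cong (_++ concatMap gapDescendants rest)
               (concatMap-filter gapDescendants part? gapDescendants-empty two) ⟩
        (gapDescendants (a , toℕ j) ++ gapDescendants (suc (toℕ j) , b) ++ []) ++ concatMap gapDescendants rest
          ≡⟨ cong (λ M → (gapDescendants (a , toℕ j) ++ M) ++ concatMap gapDescendants rest) (++-identityʳ _) ⟩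
        (gapDescendants (a , toℕ j) ++ gapDescendants (suc (toℕ j) , b)) ++ concatMap gapDescendants rest ∎))
      where
      open ≡-Reasoning
      part? : Decidable (λ ((x , y) : ℕ × ℕ) → x < y)
      part? (x , y) = x <? y
      two = (a , toℕ j) ∷ (suc (toℕ j) , b) ∷ []
      rest = otherGaps s (a , b)

    pending-choice : ¬ Gap (Vacant s) 0 n → ∀ {j : Fin n} p → toℕ j ∈ choices s →
                     pending s ↭ greatest s ∷ pending (s [ j ]≔ just p)
    pending-choice ¬all {j} p j∈ with a , b , g , eq , j∈g ← ∈-choices⁻ j∈
      with a≤j , j<b , _ ← ∈-gapFarthest⁻ (<⇒≤ (lo<hi g)) j∈g
      with old↭ , new↭ ← pending-update j p g a≤j j<b =
      subst (λ L → pending s ↭ L ∷ pending (s [ j ]≔ just p)) eq (↭-trans old↭ (↭-trans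
        (++⁺ʳ (concatMap gapDescendants (otherGaps s (a , b)))
          (gapDescendants-split (<⇒≤ (lo<hi g)) (gap-hi≤n s g) (λ { (refl , refl) → ¬all g }) j∈g))
        (↭-prep (gapLength (a , b)) (↭-sym new↭))))

    F-choice : ¬ Gap (Vacant s) 0 n → ∀ {j : Fin n} p → toℕ j ∈ choices s →
               F (pending s) ≡ length (choices s) * F (pending (s [ j ]≔ just p))
    -- `F-∷` and `middles` refer to a length minus one, so `greatest s` has to be matched as a
    -- successor; the vacant payphone `j` shows that it is positive.
    F-choice ¬all {j} p j∈ = go (greatest s) refl (proj₁ (greatest-attained (j , refl , av)))
      where
      av : Available s j
      av with a , b , g , _ , j∈g ← ∈-choices⁻ j∈
         with a≤j , j<b , _ ← ∈-gapFarthest⁻ (<⇒≤ (lo<hi g)) j∈g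
         with i , eq , av ← run g a≤j j<b
         with refl ← Fin.toℕ-injective eq = av
      s′ = s [ j ]≔ just p
      p↭ = pending-choice ¬all p j∈
      go : ∀ L → greatest s ≡ L → 0 < L → F (pending s) ≡ length (choices s) * F (pending s′)
      go (suc L) eq _ = begin
        F (pending s)                                            ≡⟨ F-↭ p↭L ⟩
        F (suc L ∷ pending s′)                                   ≡⟨ F-∷ L (pending s′) ⟩
        # (suc L) (suc L ∷ pending s′) * middles L * F (pending s′)
          ≡⟨ cong (λ k → k * middles L * F (pending s′)) (#-↭ (suc L) (↭-sym p↭L)) ⟩
        # (suc L) (pending s) * middles L * F (pending s′)       ≡⟨ cong (_* F (pending s′)) (sym (length-choices eq)) ⟩
        length (choices s) * F (pending s′)                      ∎
        where
        open ≡-Reasoning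
        p↭L : pending s ↭ suc L ∷ pending s′
        p↭L = subst (λ k → pending s ↭ k ∷ pending s′) eq p↭

-- The rule (P2)

module _ {n : ℕ} (s : State n) where

  vacant⇒available : ∀ {i} → Vacant s (toℕ i) → Available s i
  vacant⇒available (i , eq , av) = subst (Available s) (Fin.toℕ-injective eq) av

  ¬vacant⇒occupied : ∀ i → ¬ Vacant s (toℕ i) → Occupied s i
  ¬vacant⇒occupied i ¬v with lookup s i in eq
  ... | just p  = p , refl
  ... | nothing = contradiction (i , refl , eq) ¬v

  occupied⇒¬vacant : ∀ {i} → Occupied s i → ¬ Vacant s (toℕ i)
  occupied⇒¬vacant (p , occ) v with () ← trans (sym occ) (vacant⇒available v)

  -- Maximality is applied only to extensions by one payphone, on the left and on the right.
  interval⇒gap : ∀ {a b} → Interval s a b → Gap (Vacant s) (toℕ a) (suc (toℕ b))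
  interval⇒gap {a} {b} ((a≤b , av) , maximal) = record
    { lo<hi = s≤s a≤b ; run = run′ ; left = left′ ; right = right′ }
    where
    run′ : ∀ {k} → toℕ a ≤ k → k < suc (toℕ b) → Vacant s k
    run′ {k} a≤k k≤b = fromℕ< k<n , Fin.toℕ-fromℕ< k<n ,
      av (fromℕ< k<n) (subst (toℕ a ≤_) (sym (Fin.toℕ-fromℕ< k<n)) a≤k)
                      (subst (_≤ toℕ b) (sym (Fin.toℕ-fromℕ< k<n)) (s≤s⁻¹ k≤b))
      where
      k<n : k < n
      k<n = ≤-<-trans (s≤s⁻¹ k≤b) (Fin.toℕ<n b)
    left′ : ∀ {k} → suc k ≡ toℕ a → ¬ Vacant s k
    left′ eq (i , refl , avᵢ) = <⇒≢ (≤-reflexive eq) (cong toℕ (proj₁ (maximal i b i≤a ≤-refl (≤-trans i≤a a≤b , av′))))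
      where
      i≤a : toℕ i ≤ toℕ a
      i≤a = ≤-trans (n≤1+n _) (≤-reflexive eq)
      av′ : ∀ k → i Fin.≤ k → k Fin.≤ b → Available s k
      av′ k i≤k k≤b with m≤n⇒m<n∨m≡n i≤k
      ... | inj₁ i<k = av k (subst (_≤ toℕ k) eq i<k) k≤b
      ... | inj₂ i≡k = subst (Available s) (Fin.toℕ-injective i≡k) avᵢ
    right′ : ¬ Vacant s (suc (toℕ b))
    right′ (i , eq , avᵢ) = >⇒≢ (≤-reflexive (sym eq)) (cong toℕ (proj₂ (maximal a i ≤-refl b≤i (≤-trans a≤b b≤i , av′))))
      where
      b≤i : toℕ b ≤ toℕ i
      b≤i = ≤-trans (n≤1+n _) (≤-reflexive (sym eq))
      av′ : ∀ k → a Fin.≤ k → k Fin.≤ i → Available s k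
      av′ k a≤k k≤i with m≤n⇒m<n∨m≡n k≤i
      ... | inj₁ k<i = av k a≤k (s≤s⁻¹ (subst (toℕ k <_) eq k<i))
      ... | inj₂ k≡i = subst (Available s) (sym (Fin.toℕ-injective k≡i)) avᵢ

  gap⇒interval : ∀ {a b} → Gap (Vacant s) (toℕ a) (suc (toℕ b)) → Interval s a b
  gap⇒interval {a} {b} g =
    (s≤s⁻¹ (lo<hi g) , λ i a≤i i≤b → vacant⇒available (run g a≤i (s≤s i≤b))) ,
    λ a′ b′ a′≤a b≤b′ (_ , av) → Fin.toℕ-injective (≤-antisym a′≤a (≮⇒≥ (a′≮a a′ b′ b≤b′ av))) ,
                                 Fin.toℕ-injective (≤-antisym (≮⇒≥ (b≮b′ a′ b′ a′≤a av)) b≤b′)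
    where
    a′≮a : ∀ a′ b′ → b Fin.≤ b′ → (∀ i → a′ Fin.≤ i → i Fin.≤ b′ → Available s i) → ¬ toℕ a′ < toℕ a
    a′≮a a′ b′ b≤b′ av a′<a = pre (toℕ a) refl a′<a
      where
      pre : ∀ x → x ≡ toℕ a → ¬ toℕ a′ < x
      pre (suc k) eq (s≤s a′≤k) = left g eq (i , i≡k ,
        av i (subst (toℕ a′ ≤_) (sym i≡k) a′≤k)
             (≤-trans (≤-trans (≤-reflexive i≡k) (<⇒≤ k<a)) (≤-trans (s≤s⁻¹ (lo<hi g)) b≤b′)))
        where
        k<a : k < toℕ a
        k<a = ≤-reflexive eq
        k<n : k < n
        k<n = <-trans k<a (Fin.toℕ<n a)
        i = fromℕ< k<n
        i≡k = Fin.toℕ-fromℕ< k<n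
    b≮b′ : ∀ a′ b′ → a′ Fin.≤ a → (∀ i → a′ Fin.≤ i → i Fin.≤ b′ → Available s i) → ¬ toℕ b < toℕ b′
    b≮b′ a′ b′ a′≤a av b<b′ = right g (i , i≡ ,
      av i (≤-trans (≤-trans a′≤a (<⇒≤ (lo<hi g))) (≤-reflexive (sym i≡))) (≤-trans (≤-reflexive i≡) b<b′))
      where
      1+b<n : suc (toℕ b) < n
      1+b<n = ≤-<-trans b<b′ (Fin.toℕ<n b′)
      i = fromℕ< 1+b<n
      i≡ = Fin.toℕ-fromℕ< 1+b<n

  gap-ends : ∀ {x y} → Gap (Vacant s) x y → ∃ λ (a : Fin n) → ∃ λ (b : Fin n) → toℕ a ≡ x × suc (toℕ b) ≡ y
  gap-ends {x} {suc y} g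
    with a , a≡ , _ ← run g ≤-refl (lo<hi g)
       | b , b≡ , _ ← run g (s≤s⁻¹ (lo<hi g)) ≤-refl = a , b , a≡ , cong suc b≡

  flankedLeft⇒ : ∀ {a} → FlankedLeft s a → toℕ a ≢ 0
  flankedLeft⇒ (_ , eq , _) a≡0 = 1+n≢0 (trans eq a≡0)

  flankedRight⇒ : ∀ {b} → FlankedRight s b → suc (toℕ b) ≢ n
  flankedRight⇒ (i , eq , _) b≡n = <⇒≢ (Fin.toℕ<n i) (trans eq b≡n)

  module _ {a b : Fin n} (g : Gap (Vacant s) (toℕ a) (suc (toℕ b))) where

    flankedLeft⇐ : toℕ a ≢ 0 → FlankedLeft s a
    flankedLeft⇐ a≢0 = pre (toℕ a) refl a≢0
      where
      pre : ∀ x → toℕ a ≡ x → x ≢ 0 → FlankedLeft s a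
      pre zero    _  0≢0 = contradiction refl 0≢0
      pre (suc k) eq _ = fromℕ< k<n , trans (cong suc k≡) (sym eq) ,
        ¬vacant⇒occupied _ (left g (sym eq) ∘ subst (Vacant s) k≡)
        where
        k<n : k < n
        k<n = <-trans (≤-reflexive (sym eq)) (Fin.toℕ<n a)
        k≡ = Fin.toℕ-fromℕ< k<n

    flankedRight⇐ : suc (toℕ b) ≢ n → FlankedRight s b
    flankedRight⇐ b≢n = fromℕ< 1+b<n , 1+b≡ , ¬vacant⇒occupied _ (right g ∘ subst (Vacant s) 1+b≡)
      where
      1+b<n : suc (toℕ b) < n
      1+b<n = ≤∧≢⇒< (Fin.toℕ<n b) b≢n
      1+b≡ = Fin.toℕ-fromℕ< 1+b<n

    private
      x y : ℕ
      x = toℕ a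
      y = suc (toℕ b)
      size≡ : size s a b ≡ y ∸ x
      size≡ = sym (+-∸-assoc 1 (s≤s⁻¹ (lo<hi g)))

    fullLength-unique : ∀ {L} → FullLength s a b L → L ≡ gapLength n (x , y)
    fullLength-unique fl with x ≟ 0 | y ≟ n | fl
    ... | yes a≡0 | _       | closed l _         = contradiction a≡0 (flankedLeft⇒ l)
    ... | yes a≡0 | _       | semiClosedˡ l _    = contradiction a≡0 (flankedLeft⇒ l)
    ... | yes _   | _       | semiClosedʳ _ _    = cong (λ ℓ → 2 * ℓ ∸ 1) size≡
    ... | no _    | yes b≡n | closed _ r         = contradiction b≡n (flankedRight⇒ r)
    ... | no _    | yes _   | semiClosedˡ _ _    = cong (λ ℓ → 2 * ℓ ∸ 1) size≡
    ... | no _    | yes b≡n | semiClosedʳ _ r    = contradiction b≡n (flankedRight⇒ r)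
    ... | no _    | no _    | closed _ _         = size≡
    ... | no _    | no b≢n  | semiClosedˡ _ ¬r   = contradiction (flankedRight⇐ b≢n) ¬r
    ... | no a≢0  | no _    | semiClosedʳ ¬l _   = contradiction (flankedLeft⇐ a≢0) ¬l

    -- Without a flank on either side no constructor of `FullLength` applies; `¬all` excludes
    -- exactly this case.
    fullLength-exists : ¬ Gap (Vacant s) 0 n → FullLength s a b (gapLength n (x , y))
    fullLength-exists ¬all = go (kindView n λ (a≡0 , b≡n) → ¬all (subst₂ (Gap (Vacant s)) a≡0 b≡n g))
      where
      go : ∀ {κ} → KindView n x y κ → FullLength s a b (fullLength κ (y ∸ x))
      go (atStart a≡0 b≢n) = subst (λ ℓ → FullLength s a b (2 * ℓ ∸ 1)) size≡
        (semiClosedʳ (λ l → flankedLeft⇒ l a≡0) (flankedRight⇐ b≢n))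
      go (atEnd a≢0 b≡n)   = subst (λ ℓ → FullLength s a b (2 * ℓ ∸ 1)) size≡
        (semiClosedˡ (flankedLeft⇐ a≢0) (λ r → flankedRight⇒ r b≡n))
      go (inner a≢0 b≢n)   = subst (FullLength s a b) size≡ (closed (flankedLeft⇐ a≢0) (flankedRight⇐ b≢n))

    -- Every occupied payphone lies outside the run, and on each side the flanking one is nearest.
    -- Only one side has any if the run reaches an end of the row.
    closest-exists : ¬ Gap (Vacant s) 0 n → ∀ {j} → x ≤ toℕ j → toℕ j < y →
                     ClosestOccupied s j (distance (kind n x y) (y ∸ x) (toℕ j ∸ x))
    closest-exists ¬all {j} x≤j j<y = go (kindView n λ (a≡0 , b≡n) → ¬all (subst₂ (Gap (Vacant s)) a≡0 b≡n g))
      where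
      right≡ : (y ∸ x) ∸ (toℕ j ∸ x) ≡ y ∸ toℕ j
      right≡ = trans (∸-+-assoc y x (toℕ j ∸ x)) (cong (y ∸_) (m+[n∸m]≡n x≤j))
      side : ∀ {i} → Occupied s i → toℕ i < x ⊎ y ≤ toℕ i
      side {i} occ with toℕ i <? x | y ≤? toℕ i
      ... | yes i<x | _       = inj₁ i<x
      ... | no _    | yes y≤i = inj₂ y≤i
      ... | no i≮x  | no y≰i  = contradiction (run g (≮⇒≥ i≮x) (≰⇒> y≰i)) (occupied⇒¬vacant occ)
      beyondRight : ∀ {i} → y ≤ toℕ i → (y ∸ x) ∸ (toℕ j ∸ x) ≤ ∣ toℕ j - toℕ i ∣
      beyondRight {i} y≤i = begin
        (y ∸ x) ∸ (toℕ j ∸ x)  ≡⟨ right≡ ⟩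
        y ∸ toℕ j              ≤⟨ ∸-monoˡ-≤ (toℕ j) y≤i ⟩
        toℕ i ∸ toℕ j          ≡⟨ m≤n⇒∣m-n∣≡n∸m (≤-trans (<⇒≤ j<y) y≤i) ⟨
        ∣ toℕ j - toℕ i ∣      ∎
        where open ≤-Reasoning
      beyondLeft : ∀ {i} → toℕ i < x → suc (toℕ j ∸ x) ≤ ∣ toℕ j - toℕ i ∣
      beyondLeft {i} i<x = begin
        suc (toℕ j ∸ x)      ≤⟨ ∸-monoʳ-< i<x x≤j ⟩
        toℕ j ∸ toℕ i        ≡⟨ m≤n⇒∣n-m∣≡n∸m (≤-trans (<⇒≤ i<x) x≤j) ⟨
        ∣ toℕ j - toℕ i ∣    ∎
        where open ≤-Reasoning
      atRight : y ≢ n → ∃ λ i → Occupied s i × ∣ toℕ j - toℕ i ∣ ≡ (y ∸ x) ∸ (toℕ j ∸ x)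
      atRight b≢n with i , i≡y , occ ← flankedRight⇐ b≢n = i , occ ,
        trans (cong ∣ toℕ j -_∣ i≡y) (trans (m≤n⇒∣m-n∣≡n∸m (<⇒≤ j<y)) (sym right≡))
      atLeft : x ≢ 0 → ∃ λ i → Occupied s i × ∣ toℕ j - toℕ i ∣ ≡ suc (toℕ j ∸ x)
      atLeft a≢0 with i , i≡ , occ ← flankedLeft⇐ a≢0 = i , occ , (begin
        ∣ toℕ j - toℕ i ∣        ≡⟨ m≤n⇒∣n-m∣≡n∸m (≤-trans (<⇒≤ i<x) x≤j) ⟩
        suc (toℕ j) ∸ suc (toℕ i) ≡⟨ cong (suc (toℕ j) ∸_) i≡ ⟩
        suc (toℕ j) ∸ x          ≡⟨ +-∸-assoc 1 x≤j ⟩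
        suc (toℕ j ∸ x)          ∎)
        where
        open ≡-Reasoning
        i<x = ≤-reflexive i≡
      go : ∀ {κ} → KindView n x y κ → ClosestOccupied s j (distance κ (y ∸ x) (toℕ j ∸ x))
      go (atStart a≡0 b≢n) = atRight b≢n , bound
        where
        bound : ∀ i → Occupied s i → (y ∸ x) ∸ (toℕ j ∸ x) ≤ ∣ toℕ j - toℕ i ∣
        bound i occ with side occ
        ... | inj₁ i<x with () ← subst (toℕ i <_) a≡0 i<x
        ... | inj₂ y≤i = beyondRight {i} y≤i
      go (atEnd a≢0 b≡n) = atLeft a≢0 , bound
        where
        bound : ∀ i → Occupied s i → suc (toℕ j ∸ x) ≤ ∣ toℕ j - toℕ i ∣
        bound i occ with side occ
        ... | inj₁ i<x = beyondLeft {i} i<x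
        ... | inj₂ y≤i = contradiction (Fin.toℕ<n i) (≤⇒≯ (subst (_≤ toℕ i) b≡n y≤i))
      go (inner a≢0 b≢n) = attained , bound
        where
        r = (y ∸ x) ∸ (toℕ j ∸ x)
        attained : ∃ λ i → Occupied s i × ∣ toℕ j - toℕ i ∣ ≡ suc (toℕ j ∸ x) ⊓ r
        attained with ≤-total (suc (toℕ j ∸ x)) r
        ... | inj₁ l≤r = subst (λ d → ∃ λ i → Occupied s i × ∣ toℕ j - toℕ i ∣ ≡ d) (sym (m≤n⇒m⊓n≡m l≤r)) (atLeft a≢0)
        ... | inj₂ r≤l = subst (λ d → ∃ λ i → Occupied s i × ∣ toℕ j - toℕ i ∣ ≡ d) (sym (m≥n⇒m⊓n≡n r≤l)) (atRight b≢n)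
        bound : ∀ i → Occupied s i → suc (toℕ j ∸ x) ⊓ r ≤ ∣ toℕ j - toℕ i ∣
        bound i occ with side occ
        ... | inj₁ i<x = ≤-trans (m⊓n≤m _ r) (beyondLeft {i} i<x)
        ... | inj₂ y≤i = ≤-trans (m⊓n≤n (suc (toℕ j ∸ x)) r) (beyondRight {i} y≤i)

  closest-unique : ∀ {j d d′} → ClosestOccupied s j d → ClosestOccupied s j d′ → d ≡ d′
  closest-unique ((i , occ , eq) , bound) ((i′ , occ′ , eq′) , bound′) =
    ≤-antisym (≤-trans (bound i′ occ′) (≤-reflexive eq′)) (≤-trans (bound′ i occ) (≤-reflexive eq))

  module _ (¬all : ¬ Gap (Vacant s) 0 n) where

    P2-Choice⇒∈choices : ∀ {j} → P2-Choice s j → toℕ j ∈ choices n s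
    P2-Choice⇒∈choices {j} (a , b , (int , L , fl , L-max) , a≤j , j≤b , d , cl , d-max) =
      ∈-choices⁺ n s g (≤-antisym (gapLength≤greatest n s g) greatest≤) j∈
      where
      g = interval⇒gap int
      x = toℕ a
      y = suc (toℕ b)
      κ = kind n x y
      x<y = lo<hi g
      greatest≤ : greatest n s ≤ gapLength n (x , y)
      greatest≤ = maximum-≤ λ m → let (x′ , y′) , m′ , eq = ∈-map⁻ (gapLength n) m in
        ≤-trans (≤-reflexive eq) (go (∈-gaps⁻ s m′))
        where
        go : ∀ {x′ y′} → Gap (Vacant s) x′ y′ → gapLength n (x′ , y′) ≤ gapLength n (x , y)
        go h with a′ , b′ , refl , refl ← gap-ends h =
          ≤-trans (L-max a′ b′ _ (gap⇒interval h) (fullLength-exists h ¬all)) (≤-reflexive (fullLength-unique g fl))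
      farthest∋ : toℕ j ∸ x ∈ farthest κ (y ∸ x)
      farthest∋ = ∈-farthest⁺ κ (∸-monoˡ-< (s≤s j≤b) a≤j) further
        where
        -- The offset `z` is turned into the payphone at `x + z`, to which `d-max` applies.
        further : ∀ {z} → z < y ∸ x → distance κ (y ∸ x) z ≤ distance κ (y ∸ x) (toℕ j ∸ x)
        further {z} z<ℓ = begin
          distance κ (y ∸ x) z               ≡⟨ cong (distance κ (y ∸ x)) (trans (sym (m+n∸m≡n x z)) (cong (_∸ x) (sym i≡))) ⟩
          distance κ (y ∸ x) (toℕ i ∸ x)     ≤⟨ d-max i _ x≤i (s≤s⁻¹ i<y) (closest-exists g ¬all x≤i i<y) ⟩
          d                                  ≡⟨ closest-unique {j} cl (closest-exists g ¬all a≤j (s≤s j≤b)) ⟩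
          distance κ (y ∸ x) (toℕ j ∸ x)     ∎
          where
          open ≤-Reasoning
          x+z<y : x + z < y
          x+z<y = <-≤-trans (+-monoʳ-< x z<ℓ) (≤-reflexive (m+[n∸m]≡n (<⇒≤ x<y)))
          x+z<n : x + z < n
          x+z<n = <-≤-trans x+z<y (gap-hi≤n s g)
          i = fromℕ< x+z<n
          i≡ = Fin.toℕ-fromℕ< x+z<n
          x≤i : x ≤ toℕ i
          x≤i = ≤-trans (m≤m+n x z) (≤-reflexive (sym i≡))
          i<y : toℕ i < y
          i<y = subst (_< y) (sym i≡) x+z<y
      j∈ : toℕ j ∈ gapFarthest n (x , y)
      j∈ = subst (_∈ gapFarthest n (x , y)) (m+[n∸m]≡n a≤j) (∈-map⁺ (x +_) farthest∋)

    ∈choices⇒P2-Choice : ∀ {j} → toℕ j ∈ choices n s → P2-Choice s j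
    ∈choices⇒P2-Choice {j} j∈
      with x , y , g , eq , j∈g ← ∈-choices⁻ n s j∈
      with a , b , refl , refl ← gap-ends g
      with a≤j , j<y , j∈f ← ∈-gapFarthest⁻ n (<⇒≤ (lo<hi g)) j∈g =
      a , b ,
      (gap⇒interval g , _ , fullLength-exists g ¬all , λ a′ b′ L′ int′ fl′ →
        let g′ = interval⇒gap int′ in
        ≤-trans (≤-reflexive (fullLength-unique g′ fl′)) (≤-trans (gapLength≤greatest n s g′) (≤-reflexive (sym eq)))) ,
      a≤j , s≤s⁻¹ j<y , _ , closest-exists g ¬all a≤j j<y , λ i d a≤i i≤b cl →
        ≤-trans (≤-reflexive (closest-unique {i} cl (closest-exists g ¬all a≤i (s≤s i≤b))))
          (∈-farthest⁻ (kind n (toℕ a) (suc (toℕ b))) _ j∈f (∸-monoˡ-< (s≤s i≤b) a≤i))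

-- Enumeration of the reachable states

vacancies : ∀ {n} → State n → ℕ
vacancies []            = 0
vacancies (nothing ∷ s) = suc (vacancies s)
vacancies (just _ ∷ s)  = vacancies s

vacancies-replicate : ∀ n → vacancies (replicate n nothing) ≡ n
vacancies-replicate zero    = refl
vacancies-replicate (suc n) = cong suc (vacancies-replicate n)

vacancies-update : ∀ {n} (s : State n) j p → Available s j → suc (vacancies (s [ j ]≔ just p)) ≡ vacancies s
vacancies-update (nothing ∷ s) zero    p av = refl
vacancies-update (nothing ∷ s) (suc j) p av = cong suc (vacancies-update s j p av)
vacancies-update (just _ ∷ s)  (suc j) p av = vacancies-update s j p av

vacancies≢0 : ∀ {n} (s : State n) → vacancies s ≢ 0 → ∃ (Available s)
vacancies≢0 []            v≢0 = contradiction refl v≢0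
vacancies≢0 (nothing ∷ s) v≢0 = zero , refl
vacancies≢0 (just _ ∷ s)  v≢0 with i , av ← vacancies≢0 s v≢0 = suc i , av

vacancies≡0 : ∀ {n} (s : State n) → vacancies s ≡ 0 → Vec.map just (Vec.map (fromMaybe 0) s) ≡ s
vacancies≡0 []           _  = refl
vacancies≡0 (just p ∷ s) eq = cong (just p ∷_) (vacancies≡0 s eq)

-- Person `p` is new in `s′`, so it stands only at `j′` after the update, and its place reveals the
-- index.
update-index-injective : ∀ {n p} {s s′ : State n} {j j′} → (∀ i → lookup s′ i ≢ just p) →
                         s [ j ]≔ just p ≡ s′ [ j′ ]≔ just p → j ≡ j′
update-index-injective {p = p} {s} {s′} {j} {j′} fresh′ eq with j Fin.≟ j′
... | yes j≡j′ = j≡j′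
... | no  j≢j′ = contradiction
  (trans (sym (Vec.lookup∘update′ j≢j′ s′ (just p)))
    (trans (cong (λ v → lookup v j) (sym eq)) (Vec.lookup∘update j s (just p))))
  (fresh′ j)

-- Erasing the entry at `j` recovers the earlier state. Together with the previous lemma, a state
-- determines its predecessor, so different states have no common successor.
update-injective : ∀ {n p} {s s′ : State n} {j} → Available s j → Available s′ j →
                   s [ j ]≔ just p ≡ s′ [ j ]≔ just p → s ≡ s′
update-injective {p = p} {s} {s′} {j} av av′ eq =
  trans (sym (restore s av)) (trans (cong (_[ j ]≔ nothing) eq) (restore s′ av′))
  where
  restore : ∀ v → Available v j → (v [ j ]≔ just p) [ j ]≔ nothing ≡ v
  restore v av = trans (Vec.[]≔-idempotent v j) (trans (cong (v [ j ]≔_) (sym av)) (Vec.[]≔-lookup v j))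

module _ {n : ℕ} where

  P2-Choice⇒available : ∀ (s : State n) {j} → P2-Choice s j → Available s j
  P2-Choice⇒available s (a , b , (((_ , av) , _) , _) , a≤j , j≤b , _) = av _ a≤j j≤b

  -- This provides a vacancy as long as t < n, and a full row at t = n.
  reachable-vacancies : ∀ {t} {s : State n} → Reachable t s → vacancies s + t ≡ n
  reachable-vacancies (first j) = trans (+-comm _ 1)
    (trans (vacancies-update (replicate n nothing) j 1 (Vec.lookup-replicate j nothing)) (vacancies-replicate n))
  reachable-vacancies (next {t} {s} j r c) = trans (+-suc _ t)
    (trans (cong (_+ t) (vacancies-update s j (suc t) (P2-Choice⇒available s c))) (reachable-vacancies r))

  update-bound : ∀ {t} (s : State n) j {i p} → (∀ {i p} → lookup s i ≡ just p → p ≤ t) →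
                 lookup (s [ j ]≔ just (suc t)) i ≡ just p → p ≤ suc t
  update-bound s j {i} bound eq with i Fin.≟ j
  ... | yes refl = ≤-reflexive (Maybe.just-injective (trans (sym eq) (Vec.lookup∘update j s _)))
  ... | no i≢j   = m≤n⇒m≤1+n (bound (trans (sym (Vec.lookup∘update′ i≢j s _)) eq))

  empty-bound : ∀ {t i p} → lookup (replicate n nothing) i ≡ just p → p ≤ t
  empty-bound {i = i} eq with () ← trans (sym (Vec.lookup-replicate i nothing)) eq

  reachable-bound : ∀ {t} {s : State n} → Reachable t s → ∀ {i p} → lookup s i ≡ just p → p ≤ t
  reachable-bound (first j)            = update-bound (replicate n nothing) j empty-bound
  reachable-bound (next {s = s} j r _) = update-bound s j (reachable-bound r)

  fresh : ∀ {t} (s : State n) → (∀ {i p} → lookup s i ≡ just p → p ≤ t) → ∀ i → lookup s i ≢ just (suc t)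
  fresh s bound i eq = 1+n≰n (bound eq)

  reachable-occupied : ∀ {t} {s : State n} → Reachable t s → ∃ (Occupied s)
  reachable-occupied (first j)            = j , 1 , Vec.lookup∘update j (replicate n nothing) _
  reachable-occupied (next {s = s} j _ _) = j , _ , Vec.lookup∘update j s _

  reachable-notEmpty : ∀ {t} {s : State n} → Reachable t s → ¬ Gap (Vacant s) 0 n
  reachable-notEmpty {s = s} r g with i , occ ← reachable-occupied r =
    occupied⇒¬vacant s occ (run g z≤n (Fin.toℕ<n i))

  nextPayphones : State n → List (Fin n)
  nextPayphones s = filter (λ j → toℕ j ∈? choices n s) (allFin n)

  ∈-nextPayphones⁻ : ∀ s {j} → j ∈ nextPayphones s → toℕ j ∈ choices n s
  ∈-nextPayphones⁻ s = proj₂ ∘ ∈-filter⁻ (λ j → toℕ j ∈? choices n s) {xs = allFin n}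

  ∈-nextPayphones⁺ : ∀ s {j} → toℕ j ∈ choices n s → j ∈ nextPayphones s
  ∈-nextPayphones⁺ s = ∈-filter⁺ (λ j → toℕ j ∈? choices n s) (∈-allFin _)

  nextPayphones-unique : ∀ s → Unique (nextPayphones s)
  nextPayphones-unique s = Unique.filter⁺ _ (Unique.allFin⁺ n)

  length-nextPayphones : ∀ s → length (nextPayphones s) ≡ length (choices n s)
  length-nextPayphones s = trans (sym (length-map toℕ (nextPayphones s)))
    (↭-length (∼bag⇒↭ (unique∧set⇒bag (Unique.map⁺ Fin.toℕ-injective (nextPayphones-unique s))
      (choices-unique n s) (mk⇔ to from))))
    where
    to : ∀ {x} → x ∈ map toℕ (nextPayphones s) → x ∈ choices n s
    to m with j , j∈ , refl ← ∈-map⁻ toℕ m = ∈-nextPayphones⁻ s j∈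
    from : ∀ {x} → x ∈ choices n s → x ∈ map toℕ (nextPayphones s)
    from {x} m = subst (_∈ map toℕ (nextPayphones s)) x≡
      (∈-map⁺ toℕ (∈-nextPayphones⁺ s (subst (_∈ choices n s) (sym x≡) m)))
      where
      x<n : x < n
      x<n with a , b , g , _ , x∈ ← ∈-choices⁻ n s m
          with _ , x<b , _ ← ∈-gapFarthest⁻ n (<⇒≤ (lo<hi g)) x∈ = <-≤-trans x<b (gap-hi≤n s g)
      x≡ = Fin.toℕ-fromℕ< x<n

  choices-nonempty : ∀ s → ∃ (Available s) → 0 < length (choices n s)
  choices-nonempty s (i , av) =
    let _ , a , b , g , eq = greatest-attained n s (i , refl , av)
        x , x∈             = farthest-nonempty (kind n a b) (m<n⇒0<n∸m (lo<hi g))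
    in ∈-length (∈-choices⁺ n s g eq (∈-map⁺ (a +_) x∈))

  successors : ℕ → State n → List (State n)
  successors p s = map (λ j → s [ j ]≔ just p) (nextPayphones s)

-- A division-free form of "each term is X / c". When `xs` has length `c`, cancelling `c` leaves the
-- sum `X`.
sum-map-scaled : ∀ {A : Set} (g : A → ℕ) c {X} xs → (∀ {x} → x ∈ xs → X ≡ c * g x) →
                 c * sum (map g xs) ≡ length xs * X
sum-map-scaled g c []       _  = *-zeroʳ c
sum-map-scaled g c (x ∷ xs) eq = trans (*-distribˡ-+ c (g x) _)
  (cong₂ _+_ (sym (eq (here refl))) (sum-map-scaled g c xs (eq ∘ there)))

sum-concatMap : ∀ {A : Set} (g : A → ℕ) (f : A → List A) xs → (∀ {x} → x ∈ xs → sum (map g (f x)) ≡ g x) →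
                sum (map g (concatMap f xs)) ≡ sum (map g xs)
sum-concatMap g f []       _  = refl
sum-concatMap g f (x ∷ xs) eq = begin
  sum (map g (f x ++ concatMap f xs))              ≡⟨ cong sum (map-++ g (f x) _) ⟩
  sum (map g (f x) ++ map g (concatMap f xs))      ≡⟨ sum-++ (map g (f x)) _ ⟩
  sum (map g (f x)) + sum (map g (concatMap f xs)) ≡⟨ cong₂ _+_ (eq (here refl)) (sum-concatMap g f xs (eq ∘ there)) ⟩
  g x + sum (map g xs)                             ∎
  where open ≡-Reasoning

tabulate-toℕ : ∀ {A : Set} n (f : ℕ → A) → tabulate {n = n} (f ∘ toℕ) ≡ applyUpTo f n
tabulate-toℕ zero    f = refl
tabulate-toℕ (suc n) f = cong (f 0 ∷_) (tabulate-toℕ n (f ∘ suc))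

-- The invariant sum and the count

module _ {n : ℕ} where

  -- By `F-choice` every successor carries the same share of the weight of `s`. The bound `t < n`
  -- ensures that there is a choice, so that the number `c` of shares can be cancelled.
  sum-successors : ∀ {t} {s : State n} → Reachable t s → t < n → ∀ p →
                   sum (map (F ∘ pending n) (successors p s)) ≡ F (pending n s)
  sum-successors {t} {s} r t<n p = trans (cong sum (sym (map-∘ (nextPayphones s))))
    (*-cancelˡ-≡ _ _ c {{c≢0}} (begin
      c * sum (map (λ j → F (pending n (s [ j ]≔ just p))) (nextPayphones s))
        ≡⟨ sum-map-scaled _ c (nextPayphones s)
             (λ j∈ → F-choice n s (reachable-notEmpty r) p (∈-nextPayphones⁻ s j∈)) ⟩
      length (nextPayphones s) * F (pending n s)
        ≡⟨ cong (_* F (pending n s)) (length-nextPayphones s) ⟩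
      c * F (pending n s) ∎))
    where
    open ≡-Reasoning
    c = length (choices n s)
    c≢0 : NonZero c
    c≢0 = >-nonZero (choices-nonempty s (vacancies≢0 s λ v≡0 →
        <⇒≢ t<n (trans (cong (_+ t) (sym v≡0)) (reachable-vacancies r))))

  -- The empty row has the single interval (0 , n). Its parts on either side of `j` touch an end of
  -- the row and are semi-closed or empty, whence `S'` on both sides.
  pending-first : ∀ (j : Fin n) →
    pending n (replicate n nothing [ j ]≔ just 1) ↭ S' (toℕ j) ∪ S' (n ∸ suc (toℕ j))
  pending-first j = ↭-trans (proj₂ (pending-update n ε j 1 whole z≤n (Fin.toℕ<n j))) (↭-reflexive (begin
    (S' (toℕ j) ∪ gapDescendants n (suc (toℕ j) , n)) ∪ concatMap (gapDescendants n) (otherGaps ε (0 , n))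
      ≡⟨ cong₂ _∪_ (cong (S' (toℕ j) ∪_) (gapDescendants-atEnd n 1+n≢0)) (cong (concatMap (gapDescendants n)) no-others) ⟩
    (S' (toℕ j) ∪ S' (n ∸ suc (toℕ j))) ∪ []
      ≡⟨ ++-identityʳ _ ⟩
    S' (toℕ j) ∪ S' (n ∸ suc (toℕ j)) ∎))
    where
    open ≡-Reasoning
    ε = replicate n nothing
    whole : Gap (Vacant ε) 0 n
    whole = record
      { lo<hi = ≤-<-trans z≤n (Fin.toℕ<n j)
      ; run   = λ _ k<n → fromℕ< k<n , Fin.toℕ-fromℕ< k<n , Vec.lookup-replicate (fromℕ< k<n) nothing
      ; left  = λ ()
      ; right = λ v → n≮n n (vacant-< ε v)
      }
    no-others : otherGaps ε (0 , n) ≡ []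
    no-others = filter-none (λ x → ¬? (≡-dec _≟_ _≟_ x (0 , n)))
      (All.tabulate λ m ¬≡ → ¬≡ (only (∈-gaps⁻ ε m)))
      where
      only : ∀ {x y} → Gap (Vacant ε) x y → (x , y) ≡ (0 , n)
      only g with refl , refl ← gap-unique g whole ≤-refl (lo<hi g) z≤n (<-≤-trans (lo<hi g) (gap-hi≤n ε g)) = refl

  total : ℕ
  total = sum (map (λ i → F (S' (i ∸ 1) ∪ S' (n ∸ i))) [1⋯ n ])

  -- The sum is carried in the same induction as the list, because its step needs all listed states
  -- to be reachable.
  record Enumeration (t : ℕ) : Set where
    field
      states     : List (State n)
      unique     : Unique states
      sound      : ∀ {s} → s ∈ states → Reachable t s
      complete   : ∀ {s} → Reachable t s → s ∈ states
      sum≡total  : sum (map (F ∘ pending n) states) ≡ total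

  open Enumeration

  enumerate : ∀ t → suc t ≤ n → Enumeration (suc t)
  enumerate zero _ = record
    { states = map start (allFin n)
    ; unique = Unique.map⁺ (update-index-injective {s = ε} (fresh ε (λ {i} → empty-bound {i = i}))) (Unique.allFin⁺ n)
    ; sound = λ m → let j , _ , eq = ∈-map⁻ start m in subst (Reachable 1) (sym eq) (first j)
    ; complete = λ r → complete₁ r refl
    ; sum≡total = begin
        sum (map (F ∘ pending n) (map start (allFin n)))
          ≡⟨ cong sum (sym (map-∘ (allFin n))) ⟩
        sum (map (F ∘ pending n ∘ start) (allFin n))
          ≡⟨ cong sum (map-cong (λ j → F-↭ (pending-first j)) (allFin n)) ⟩
        sum (map (λ j → F (S' (toℕ j) ∪ S' (n ∸ suc (toℕ j)))) (allFin n))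
          ≡⟨ cong sum (map-tabulate {n = n} id (λ j → F (S' (toℕ j) ∪ S' (n ∸ suc (toℕ j))))) ⟩
        sum (tabulate {n = n} (λ j → F (S' (toℕ j) ∪ S' (n ∸ suc (toℕ j)))))
          ≡⟨ cong sum (tabulate-toℕ n (λ i → F (S' i ∪ S' (n ∸ suc i)))) ⟩
        sum (applyUpTo (λ i → F (S' i ∪ S' (n ∸ suc i))) n)
          ≡⟨ cong sum (sym (map-applyUpTo suc (λ i → F (S' (i ∸ 1) ∪ S' (n ∸ i))) n)) ⟩
        total ∎
    }
    where
    open ≡-Reasoning
    ε = replicate n nothing
    start : Fin n → State n
    start j = ε [ j ]≔ just 1
    -- The number of persons is a variable with an equation so that `Reachable` can be matched; a
    -- `next` would require an inhabitant of `Reachable 0`.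
    complete₁ : ∀ {t s} → Reachable t s → t ≡ 1 → s ∈ map start (allFin n)
    complete₁ (first j)              _    = ∈-map⁺ start (∈-allFin j)
    complete₁ (next _ (first _) _)   ()
    complete₁ (next _ (next _ _ _) _) ()
  enumerate (suc t) 2+t≤n = record
    { states = concatMap (successors (2 + t)) (states E)
    ; unique = concatMap-unique (unique E)
        (λ {s} s∈ → Unique.map⁺ (update-index-injective {s = s} (fresh s (reachable-bound (sound E s∈))))
                                (nextPayphones-unique s))
        separate
    ; sound = λ m → sound′ (∈-concatMap⁻′ (successors (2 + t)) m)
    ; complete = λ r → complete′ r refl
    ; sum≡total = trans (sum-concatMap _ _ (states E) (λ s∈ → sum-successors (sound E s∈) 2+t≤n (2 + t))) (sum≡total E)
    }
    where
    E = enumerate t (<⇒≤ 2+t≤n)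
    choice : ∀ {s j} → s ∈ states E → j ∈ nextPayphones s → P2-Choice s j
    choice {s} s∈ j∈ = ∈choices⇒P2-Choice s (reachable-notEmpty (sound E s∈)) (∈-nextPayphones⁻ s j∈)
    separate : ∀ {s s′ u} → s ∈ states E → s′ ∈ states E →
               u ∈ successors (2 + t) s → u ∈ successors (2 + t) s′ → s ≡ s′
    separate {s} {s′} s∈ s′∈ u∈ u∈′
      with j , j∈ , eq ← ∈-map⁻ (λ j → s [ j ]≔ just (2 + t)) u∈
         | j′ , j′∈ , eq′ ← ∈-map⁻ (λ j → s′ [ j ]≔ just (2 + t)) u∈′
      with refl ← update-index-injective {s = s} {s′} (fresh s′ (reachable-bound (sound E s′∈))) (trans (sym eq) eq′) =
      update-injective (P2-Choice⇒available s (choice s∈ j∈)) (P2-Choice⇒available s′ (choice s′∈ j′∈))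
                       (trans (sym eq) eq′)
    sound′ : ∀ {u} → (∃ λ s → s ∈ states E × u ∈ successors (2 + t) s) → Reachable (2 + t) u
    sound′ (s , s∈ , u∈) with j , j∈ , refl ← ∈-map⁻ (λ j → s [ j ]≔ just (2 + t)) u∈ =
      next j (sound E s∈) (choice s∈ j∈)
    complete′ : ∀ {k u} → Reachable k u → k ≡ 2 + t → u ∈ concatMap (successors (2 + t)) (states E)
    complete′ (next {s = s} j r c) refl = ∈-concatMap⁺′ (successors (2 + t)) (complete E r)
      (∈-map⁺ _ (∈-nextPayphones⁺ s (P2-Choice⇒∈choices s (reachable-notEmpty r) c)))

  pending-full : ∀ {s : State n} → vacancies s ≡ 0 → pending n s ≡ []
  pending-full {s} full = none (gaps s) (∈-gaps⁻ s)
    where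
    none : ∀ gs → (∀ {a b} → (a , b) ∈ gs → Gap (Vacant s) a b) → concatMap (gapDescendants n) gs ≡ []
    none []      _ = refl
    -- Any interval contains a vacant payphone, and filling it would lower a count that is already
    -- 0. The person 0 is an arbitrary entry.
    none (_ ∷ _) gap with g ← gap (here refl) with i , _ , av ← run g ≤-refl (lo<hi g) =
      contradiction (trans (vacancies-update s i 0 av) full) 1+n≢0

  reachable-full : ∀ {s : State n} → Reachable n s → vacancies s ≡ 0
  reachable-full r = +-cancelʳ-≡ n _ 0 (reachable-vacancies r)

theorem4 : (n : ℕ) → n ≥ 1 →
    HasCardinality (P2-Permutation n)
    (sum (map (λ i → F (S' (i ∸ 1) ∪ S' (n ∸ i))) [1⋯ n ]))
theorem4 (suc m) _ = map persons (states E) , Unique.map⁻ (subst Unique (sym just-persons) (unique E)) ,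
  (λ p → mk⇔ (to p) (from p)) , trans (length-map persons (states E)) (trans (sym all-one) (sum≡total E))
  where
  open Enumeration
  E = enumerate m ≤-refl
  -- The default 0 never shows up on the listed states, in which no payphone is left vacant.
  persons : State (suc m) → Vec ℕ (suc m)
  persons = Vec.map (fromMaybe 0)
  full : ∀ {s} → s ∈ states E → Vec.map just (persons s) ≡ s
  full s∈ = vacancies≡0 _ (reachable-full (sound E s∈))
  -- `Vec.map just` turns the permutations back into the listed states, so the absence of
  -- repetitions carries over to them.
  just-persons : map (Vec.map just) (map persons (states E)) ≡ states E
  just-persons = trans (sym (map-∘ (states E))) (map-id-local (All.tabulate full))
  to : ∀ p → p ∈ map persons (states E) → P2-Permutation (suc m) p
  to p p∈ with s , s∈ , refl ← ∈-map⁻ persons p∈ = subst (Reachable (suc m)) (sym (full s∈)) (sound E s∈)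
  from : ∀ p → P2-Permutation (suc m) p → p ∈ map persons (states E)
  from p r = subst (_∈ map persons (states E)) (trans (sym (Vec.map-∘ _ _ p)) (Vec.map-id p))
    (∈-map⁺ persons (complete E r))
  all-one : sum (map (F ∘ pending (suc m)) (states E)) ≡ length (states E)
  all-one = ones (states E) λ s∈ → cong F (pending-full (reachable-full (sound E s∈)))
    where
    ones : ∀ {g : State (suc m) → ℕ} xs → (∀ {x} → x ∈ xs → g x ≡ 1) → sum (map g xs) ≡ length xs
    ones []       _  = refl
    ones (x ∷ xs) eq = cong₂ _+_ (eq (here refl)) (ones xs (eq ∘ there))
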